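{- Let $(\mathbf F,\prec)$ be an IS-family over a finite set $V$ with $n=|V|$, accessed through the procedures guaranteed by its (EC) condition, and let $r=|sm(\mathbf F)|$. Then for every integer $x\ge0$, the family $\mathbf{Pr}_x$ can be computed in time $O(n^3 2^{2x} r^2 (r+x)^2)$.
   Context: Let $V$ be a finite set, $n=|V|$, $\mathbf F$ a family of subsets of $V$ and $\prec$ a strict partial order on $\mathbf F$; $S\preceq S'$ means $S\prec S'$ or $S=S'$. For $S\in\mathbf F$ and $v\in V$, $S$ covers $v$ if there is $S'\in\mathbf F$ with $S'\prec S$ and $v\in S'\setminus S$. $Pred(S)$ is the set of $S'\in\mathbf F$ with $S'\prec S$ such that there is no $S''\in\mathbf F$ with $S'\prec S''\prec S$. The visible set $Vis(S)$ is the set of $v\in V$ such that $v\in S'$ for some $S'\in Pred(S)$ and $v$ is not covered by any element of $Pred(S)$. For $S\in\mathbf F$ and $v\in S$, a witness of $v$ w.r.t. $S$ is a $\prec$-minimal element $S'\in\mathbf F$ with $S\prec S'$ and $v\in S\setminus S'$. $(\mathbf F,\prec)$ is an IS-family if: (SE) there is a unique element $sm(\mathbf F)\in\mathbf F$ with $sm(\mathbf F)\prec S$ for every other $S\in\mathbf F$; (SM) $S_1\prec S_2$ implies $|S_1|<|S_2|$; (SW) for every $S\in\mathbf F$ and $v\in S$ there is at most one witness of $v$ w.r.t. $S$; (TE) if $S_1\prec S_2\prec S_3$ are in $\mathbf F$ and $v\in S_1\setminus S_2$ then $v\in S_1\setminus S_3$; (LVS) for every $S\in\mathbf F$ and $S'\in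 Pred(S)$, $|S'|\le |Vis(S)|$; (DVS) for every $S\in\mathbf F$ with $S\ne sm(\mathbf F)$, $Vis(S)$ is not a subset of $S$; (EC) $sm(\mathbf F)$ can be computed in $O(n^3)$ time, for given $S\in\mathbf F$ and $v\in S$ the witness of $v$ w.r.t. $S$ can be computed (or its nonexistence reported) in $O(n^3)$ time, and $S_1\prec S_2$ can be tested in $O(|S_1|)$ time. Notation: $hat(S)=S\setminus\bigcup_{S'\prec S}S'$; $ex(S)=|S|-|sm(\mathbf F)|$; $S\in\mathbf F$ is principal if $hat(S)\ne\emptyset$; $\mathbf{Pr}_x$ is the family of all principal sets $S\in\mathbf F$ with $ex(S)\le x$. -}

module Defs where

open import Data.Bool.Base using (Bool; true; false)
open import Data.Fin.Base using (Fin; zero; toℕ)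
open import Data.Fin.Subset using (Subset; _∈_; _∉_; _⊆_; ∣_∣; Nonempty)
open import Data.Fin.Subset.Properties using (_∈?_; anySubset?)
open import Data.List.Base using (List; []; _∷_; replicate)
open import Data.List.Relation.Unary.Unique.Propositional using (Unique)
open import Data.Maybe.Base using (Maybe; just; nothing)
open import Data.Nat.Base using (ℕ; _+_; _*_; _∸_; _^_; _≤_; _<_)
open import Data.Product using (∃!; ∃-syntax; _×_; proj₁)
open import Data.Unit.Base using (tt)
open import Data.Vec.Base as Vec using (Vec; lookup; tabulate; toList; _[_]≔_)
open import Function.Base using (_∘_)
open import Function.Bundles using (_⇔_)
open import Level using (0ℓ)
open import Relation.Binary.Core using (Rel)
open import Relation.Binary.Definitions as B using ()
open import Relation.Binary.PropositionalEquality using (_≡_; _≢_)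
open import Relation.Binary.Structures using (IsStrictPartialOrder)
open import Relation.Nullary using (¬_; Dec; does; ¬?; _×-dec_)
open import Relation.Unary using (Pred; Decidable)
import Data.List.Membership.Propositional as List

-- The ground set V is Fin n.  Decidability is automatic classically (everything
-- is finite); it is what lets Vis and hat below be finite sets with a cardinality.
record SetFamily (n : ℕ) : Set₁ where
  infix 4 _≺_ _≺?_
  field
    𝐅                    : Pred (Subset n) 0ℓ
    𝐅?                   : Decidable 𝐅
    _≺_                  : Rel (Subset n) 0ℓ
    _≺?_                 : B.Decidable _≺_
    -- ≺ is a relation on 𝐅, not on all subsets of V
    ≺⇒𝐅                  : ∀ {S S′} → S ≺ S′ → 𝐅 S × 𝐅 S′
    isStrictPartialOrder : IsStrictPartialOrder _≡_ _≺_

comprehension : ∀ {n} {P : Pred (Fin n) 0ℓ} → Decidable P → Subset n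
comprehension P? = tabulate (does ∘ P?)

module Notions {n : ℕ} (𝓕 : SetFamily n) where
  open SetFamily 𝓕

  Covers : Subset n → Fin n → Set
  Covers S v = ∃[ S′ ] (𝐅 S′ × S′ ≺ S × v ∈ S′ × v ∉ S)

  covers? : ∀ S v → Dec (Covers S v)
  covers? S v = anySubset? λ S′ →
    𝐅? S′ ×-dec S′ ≺? S ×-dec v ∈? S′ ×-dec ¬? (v ∈? S)

  -- S′ ∈ Pred(S)
  IsPred : Subset n → Subset n → Set
  IsPred S S′ = 𝐅 S′ × S′ ≺ S × ¬ (∃[ S″ ] (𝐅 S″ × S′ ≺ S″ × S″ ≺ S))

  isPred? : ∀ S S′ → Dec (IsPred S S′)
  isPred? S S′ = 𝐅? S′ ×-dec S′ ≺? S ×-dec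
    ¬? (anySubset? λ S″ → 𝐅? S″ ×-dec S′ ≺? S″ ×-dec S″ ≺? S)

  Visible : Subset n → Fin n → Set
  Visible S v = (∃[ S′ ] (IsPred S S′ × v ∈ S′)) × ¬ (∃[ S′ ] (IsPred S S′ × Covers S′ v))

  visible? : ∀ S v → Dec (Visible S v)
  visible? S v =
    anySubset? (λ S′ → isPred? S S′ ×-dec v ∈? S′) ×-dec
    ¬? (anySubset? λ S′ → isPred? S S′ ×-dec covers? S′ v)

  Vis : Subset n → Subset n
  Vis S = comprehension (visible? S)

  Drops : Subset n → Fin n → Subset n → Set
  Drops S v S′ = 𝐅 S′ × S ≺ S′ × v ∈ S × v ∉ S′

  IsWitness : Subset n → Fin n → Subset n → Set
  IsWitness S v S′ = Drops S v S′ × ¬ (∃[ S″ ] (Drops S v S″ × S″ ≺ S′))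

  IsWitnessAnswer : Subset n → Fin n → Maybe (Subset n) → Set
  IsWitnessAnswer S v (just W) = IsWitness S v W
  IsWitnessAnswer S v nothing  = ¬ (∃[ W ] IsWitness S v W)

  IsSmallest : Subset n → Set
  IsSmallest M = 𝐅 M × (∀ S → 𝐅 S → S ≢ M → M ≺ S)

  InHat : Subset n → Fin n → Set
  InHat S v = v ∈ S × ¬ (∃[ S′ ] (𝐅 S′ × S′ ≺ S × v ∈ S′))

  inHat? : ∀ S v → Dec (InHat S v)
  inHat? S v = v ∈? S ×-dec
    ¬? (anySubset? λ S′ → 𝐅? S′ ×-dec S′ ≺? S ×-dec v ∈? S′)

  hat : Subset n → Subset n
  hat S = comprehension (inHat? S)

  Principal : Subset n → Set
  Principal S = 𝐅 S × Nonempty (hat S)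

-- c is the constant hidden in the O(·)'s.  The times are those of the individual
-- calls, and are only constrained on legitimate arguments.
record EC (c : ℕ) {n : ℕ} (𝓕 : SetFamily n) : Set where
  open SetFamily 𝓕
  open Notions 𝓕
  field
    smTime            : ℕ
    smTime-bound      : smTime ≤ c * n ^ 3
    witness           : Subset n → Fin n → Maybe (Subset n)
    witness-correct   : ∀ {S v} → 𝐅 S → v ∈ S → IsWitnessAnswer S v (witness S v)
    witnessTime       : Subset n → Fin n → ℕ
    witnessTime-bound : ∀ {S v} → 𝐅 S → v ∈ S → witnessTime S v ≤ c * n ^ 3
    ≺Time             : Subset n → Subset n → ℕ
    ≺Time-bound       : ∀ {S₁ S₂} → 𝐅 S₁ → 𝐅 S₂ → ≺Time S₁ S₂ ≤ c * ∣ S₁ ∣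

record IsISFamily (c : ℕ) {n : ℕ} (𝓕 : SetFamily n) : Set where
  open SetFamily 𝓕
  open Notions 𝓕
  field
    SE  : ∃! _≡_ IsSmallest
    SM  : ∀ {S₁ S₂} → 𝐅 S₁ → 𝐅 S₂ → S₁ ≺ S₂ → ∣ S₁ ∣ < ∣ S₂ ∣
    SW  : ∀ {S v} → 𝐅 S → v ∈ S → ∀ {W W′} → IsWitness S v W → IsWitness S v W′ → W ≡ W′
    TE  : ∀ {S₁ S₂ S₃ v} → 𝐅 S₁ → 𝐅 S₂ → 𝐅 S₃ → S₁ ≺ S₂ → S₂ ≺ S₃ →
          v ∈ S₁ × v ∉ S₂ → v ∈ S₁ × v ∉ S₃
    LVS : ∀ {S S′} → 𝐅 S → IsPred S S′ → ∣ S′ ∣ ≤ ∣ Vis S ∣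
    DVS : ∀ {S} → 𝐅 S → S ≢ proj₁ SE → ¬ (Vis S ⊆ S)
    ec  : EC c 𝓕

  sm : Subset n
  sm = proj₁ SE

  -- Truncated subtraction is exact on 𝐅, by SE and SM.
  ex : Subset n → ℕ
  ex S = ∣ S ∣ ∸ ∣ sm ∣

  Pr : ℕ → Pred (Subset n) 0ℓ
  Pr x S = Principal S × ex S ≤ x

-- Model of computation: WHILE programs over binary trees (Jones, "Computability
-- and Complexity from a Programming Perspective") with the unit-cost time
-- measure, extended by calls to the three procedures of condition EC.  A variable
-- holds a pointer to an immutable cons cell, so each unit of cost is a
-- constant-time operation of a pointer machine or a RAM.

infixr 5 _∙_

data Tree : Set where
  nil : Tree
  _∙_ : Tree → Tree → Tree

hd tl : Tree → Tree
hd nil     = nil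
hd (a ∙ _) = a
tl nil     = nil
tl (_ ∙ b) = b

data Expr (k : ℕ) : Set where
  var    : Fin k → Expr k
  `nil   : Expr k
  `cons  : Expr k → Expr k → Expr k
  `hd `tl : Expr k → Expr k

infix  6 _≔_ _≔sm _≔witness_,_ _≔precedes_,_
infixr 5 _⨾_

data Cmd (k : ℕ) : Set where
  skip           : Cmd k
  _≔_            : Fin k → Expr k → Cmd k
  _⨾_            : Cmd k → Cmd k → Cmd k
  if_then_else_  : Expr k → Cmd k → Cmd k → Cmd k
  while_loop_    : Expr k → Cmd k → Cmd k
  _≔sm           : Fin k → Cmd k
  _≔witness_,_   : Fin k → Expr k → Expr k → Cmd k
  _≔precedes_,_  : Fin k → Expr k → Expr k → Cmd k

encodeBool : Bool → Tree
encodeBool false = nil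
encodeBool true  = nil ∙ nil

encodeList : {A : Set} → (A → Tree) → List A → Tree
encodeList enc []       = nil
encodeList enc (a ∷ as) = enc a ∙ encodeList enc as

encodeℕ : ℕ → Tree
encodeℕ m = encodeList (λ _ → nil) (replicate m tt)

encodeFin : ∀ {n} → Fin n → Tree
encodeFin v = encodeℕ (toℕ v)

encodeSubset : ∀ {n} → Subset n → Tree
encodeSubset S = encodeList encodeBool (toList S)

encodeMaybe : {A : Set} → (A → Tree) → Maybe A → Tree
encodeMaybe enc nothing  = nil
encodeMaybe enc (just a) = enc a ∙ nil

encodeFamily : ∀ {n} → List (Subset n) → Tree
encodeFamily = encodeList encodeSubset

Store : ℕ → Set
Store k = Vec Tree k

eval : ∀ {k} → Expr k → Store k → Tree
eval (var i)      σ = lookup σ i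
eval `nil         σ = nil
eval (`cons e e′) σ = eval e σ ∙ eval e′ σ
eval (`hd e)      σ = hd (eval e σ)
eval (`tl e)      σ = tl (eval e σ)

cost : ∀ {k} → Expr k → ℕ
cost (var _)      = 1
cost `nil         = 1
cost (`cons e e′) = 1 + cost e + cost e′
cost (`hd e)      = 1 + cost e
cost (`tl e)      = 1 + cost e

module Semantics {c n : ℕ} {𝓕 : SetFamily n} (I : IsISFamily c 𝓕) {k : ℕ} where
  open SetFamily 𝓕
  open IsISFamily I
  open EC ec

  -- Exec C σ σ′ t : started in σ, C halts in σ′ after time t.  In tests nil is false
  -- and every other tree is true.  A procedure call on illegitimate arguments has no
  -- rule, so a program that makes one does not halt.
  data Exec : Cmd k → Store k → Store k → ℕ → Set where
    skip : ∀ {σ} → Exec skip σ σ 1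

    assign : ∀ {i e σ} → Exec (i ≔ e) σ (σ [ i ]≔ eval e σ) (1 + cost e)

    seq : ∀ {C C′ σ σ′ σ″ t t′} →
      Exec C σ σ′ t → Exec C′ σ′ σ″ t′ → Exec (C ⨾ C′) σ σ″ (t + t′)

    if-true : ∀ {e C C′ σ σ′ t} → eval e σ ≢ nil →
      Exec C σ σ′ t → Exec (if e then C else C′) σ σ′ (1 + cost e + t)

    if-false : ∀ {e C C′ σ σ′ t} → eval e σ ≡ nil →
      Exec C′ σ σ′ t → Exec (if e then C else C′) σ σ′ (1 + cost e + t)

    while-true : ∀ {e C σ σ′ σ″ t t′} → eval e σ ≢ nil →
      Exec C σ σ′ t → Exec (while e loop C) σ′ σ″ t′ →
      Exec (while e loop C) σ σ″ (1 + cost e + t + t′)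

    while-false : ∀ {e C σ} → eval e σ ≡ nil →
      Exec (while e loop C) σ σ (1 + cost e)

    call-sm : ∀ {i σ} → Exec (i ≔sm) σ (σ [ i ]≔ encodeSubset sm) (1 + smTime)

    call-witness : ∀ {i e e′ σ S v} →
      eval e σ ≡ encodeSubset S → eval e′ σ ≡ encodeFin v → 𝐅 S → v ∈ S →
      Exec (i ≔witness e , e′) σ
           (σ [ i ]≔ encodeMaybe encodeSubset (witness S v))
           (1 + cost e + cost e′ + witnessTime S v)

    call-≺ : ∀ {i e e′ σ S₁ S₂} →
      eval e σ ≡ encodeSubset S₁ → eval e′ σ ≡ encodeSubset S₂ → 𝐅 S₁ → 𝐅 S₂ →
      Exec (i ≔precedes e , e′) σ
           (σ [ i ]≔ encodeBool (does (S₁ ≺? S₂)))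
           (1 + cost e + cost e′ + ≺Time S₁ S₂)

-- Besides the procedures, a program is given n and x (in unary, which the time
-- bound 2^(2x) absorbs); its other variables start out as nil.
initial : ∀ {k} → ℕ → ℕ → Store (2 + k)
initial {k} n x = encodeℕ n Vec.∷ encodeℕ x Vec.∷ Vec.replicate k nil

-- The program halts within time T, its first variable holding a repetition-free
-- list of the members of 𝐏𝐫ₓ.
ComputesPr : ∀ {c n k} {𝓕 : SetFamily n} → IsISFamily c 𝓕 → Cmd (2 + k) → ℕ → ℕ → Set
ComputesPr {n = n} I P x T =
  ∃[ σ ] ∃[ t ] ∃[ Ss ]
    ( Exec P (initial n x) σ t
    × t ≤ T
    × lookup σ zero ≡ encodeFamily Ss
    × Unique Ss
    × (∀ S → S List.∈ Ss ⇔ Pr x S))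
  where
    open IsISFamily I
    open Semantics I

bound : ℕ → ℕ → ℕ → ℕ
bound n r x = n ^ 3 * 2 ^ (2 * x) * r ^ 2 * (r + x) ^ 2

{-# OPTIONS --safe #-}
module Submission where

-- Every S ∈ 𝐅 other than sm is a witness: by DVS some v ∈ Vis S is missing from S, and if
-- T is a ≺-minimal set containing v below a predecessor of S, then v ∈ hat T and, as no
-- predecessor of S covers v, S is the witness of v with respect to T.  So all sets of excess
-- at most x are found by closing {sm} under witnesses of size at most |sm| + x.
--
-- To bound their number, hat S and Vis S are disjoint, so LVS gives
-- |hat S| ≤ |Vis S \ S| + |S| - |P| for every predecessor P of S.  Give each pair (T , v)
-- with v ∈ hat T the weight 2 ^ (1 + x - ex T) - 1 and send it to the witness of v with
-- respect to T.  Each S ≠ sm then receives at least 1 more than the total weight of its own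
-- pairs, while only the pairs of sm are not paid for: there are at most
-- 1 + |sm| (2 ^ (1 + x) - 1) sets of excess at most x.
--
-- Membership in the list of sets found so far is tested by linear search, and S is kept in
-- the end if something remains of it after removing all listed T ≺ S.

open import Defs
open import Algebra.Lattice.Properties.BooleanAlgebra using (deMorgan₂)
open import Data.Bool.Base as Bool using (Bool; true; false; not; _∧_)
import Data.Bool.Properties as Bool
open import Data.Fin.Base using (Fin; zero; suc; toℕ)
open import Data.Fin using (#_)
import Data.Fin.Properties as Fin
open import Data.Fin.Subset using (Subset; inside; outside; _∈_; _∉_; ∣_∣; _─_; Nonempty)
open import Data.Fin.Subset.Properties using (_∈?_; anySubset?; ∣p∣≤n; x∈p∧x∉q⇒x∈p─q; p─q⊆p)
open import Data.List.Base using (List; []; _∷_; _++_; _ʳ++_; map; filter; length; tabulate; allFin)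
open import Data.List.Membership.Propositional using () renaming (_∈_ to _∈ˡ_; _∉_ to _∉ˡ_)
open import Data.List.Membership.Propositional.Properties using (∈-filter⁺; ∈-filter⁻; ∈-allFin; ∈-map⁺; ∈-map⁻; ∈-++⁺ˡ; ∈-++⁺ʳ)
open import Data.List.Properties using (ʳ++-ʳ++; ++-identityʳ; length-ʳ++)
open import Data.List.Relation.Unary.All as All using (All; []; _∷_)
open import Data.List.Relation.Unary.Any as Any using (here; there; any?)
open import Data.List.Relation.Unary.Unique.Propositional using (Unique; []; _∷_)
import Data.List.Relation.Unary.Unique.Propositional.Properties as Unique
open import Data.Maybe.Base using (Maybe; just; nothing)
import Data.Maybe.Properties as Maybe
open import Data.Nat.Base using (ℕ; zero; suc; _+_; _*_; _∸_; _^_; _⊔_; _≤_; _<_; _≤ᵇ_; z≤n; s≤s)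
open import Data.Nat.Induction using (<-wellFounded)
open import Data.Nat.Properties
open import Data.Nat.Solver using (module +-*-Solver)
open import Data.Product using (Σ-syntax; ∃-syntax; _×_; _,_; proj₁; proj₂)
open import Data.Sum.Base using (_⊎_; inj₁; inj₂)
open import Data.Vec.Base as Vec using ([]; _∷_; toList; lookup; _[_]≔_) renaming (here to hereⱽ; there to thereⱽ)
import Data.Vec.Properties as Vec
open import Function.Base using (_∘_; id)
open import Function.Bundles using (_⇔_; mk⇔)
open import Induction.WellFounded using (Acc; acc)
open import Relation.Binary.PropositionalEquality using (_≡_; _≢_; refl; sym; trans; cong; cong₂; subst)
open import Relation.Binary.Structures using (IsStrictPartialOrder)
open import Relation.Nullary using (¬_; Dec; yes; no; does; ¬?; _×-dec_; contradiction)
open import Relation.Nullary.Decidable using (dec-true; dec-false; decidable-stable)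

-- Finite sums over lists and counting by indicators.

∑ : ∀ {A : Set} → List A → (A → ℕ) → ℕ
∑ []       f = 0
∑ (x ∷ xs) f = f x + ∑ xs f

∑-mono : ∀ {A : Set} (xs : List A) {f g : A → ℕ} → (∀ {x} → x ∈ˡ xs → f x ≤ g x) → ∑ xs f ≤ ∑ xs g
∑-mono []       f≤g = z≤n
∑-mono (x ∷ xs) f≤g = +-mono-≤ (f≤g (here refl)) (∑-mono xs (f≤g ∘ there))

∑-cong : ∀ {A : Set} (xs : List A) {f g : A → ℕ} → (∀ x → f x ≡ g x) → ∑ xs f ≡ ∑ xs g
∑-cong []       f≡g = refl
∑-cong (x ∷ xs) f≡g = cong₂ _+_ (f≡g x) (∑-cong xs f≡g)

∑-distrib-+ : ∀ {A : Set} (xs : List A) {f g : A → ℕ} → ∑ xs (λ x → f x + g x) ≡ ∑ xs f + ∑ xs g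
∑-distrib-+ []       = refl
∑-distrib-+ (x ∷ xs) {f} {g} = trans (cong (f x + g x +_) (∑-distrib-+ xs))
  (solve 4 (λ a b c d → (a :+ b) :+ (c :+ d) := (a :+ c) :+ (b :+ d)) refl (f x) (g x) (∑ xs f) (∑ xs g))
  where open +-*-Solver

*-distribʳ-∑ : ∀ {A : Set} (xs : List A) {f : A → ℕ} k → ∑ xs (λ x → f x * k) ≡ ∑ xs f * k
*-distribʳ-∑ []           k = refl
*-distribʳ-∑ (x ∷ xs) {f} k = trans (cong (f x * k +_) (*-distribʳ-∑ xs k)) (sym (*-distribʳ-+ k (f x) (∑ xs f)))

∑-zero : ∀ {A : Set} (xs : List A) → ∑ xs (λ _ → 0) ≡ 0
∑-zero []       = refl
∑-zero (x ∷ xs) = ∑-zero xs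

∑-one : ∀ {A : Set} (xs : List A) → ∑ xs (λ _ → 1) ≡ length xs
∑-one []       = refl
∑-one (x ∷ xs) = cong suc (∑-one xs)

∑-comm : ∀ {A B : Set} (xs : List A) (ys : List B) (f : A → B → ℕ) →
  ∑ xs (λ x → ∑ ys (f x)) ≡ ∑ ys (λ y → ∑ xs (λ x → f x y))
∑-comm []       ys f = sym (∑-zero ys)
∑-comm (x ∷ xs) ys f = trans (cong (∑ ys (f x) +_) (∑-comm xs ys f)) (sym (∑-distrib-+ ys))

∈⇒≤∑ : ∀ {A : Set} {xs : List A} {x} (f : A → ℕ) → x ∈ˡ xs → f x ≤ ∑ xs f
∈⇒≤∑ {xs = x ∷ xs} f (here refl) = m≤m+n (f x) (∑ xs f)
∈⇒≤∑ {xs = x ∷ xs} f (there p)   = ≤-trans (∈⇒≤∑ f p) (m≤n+m (∑ xs f) (f x))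

-- A surplus `d` at one index survives the summation; in the count below it is the surplus received
-- at a single dropped vertex.
∑-mono-gap : ∀ {A : Set} {xs : List A} {f g : A → ℕ} {x} d → (∀ y → f y ≤ g y) →
  x ∈ˡ xs → f x + d ≤ g x → ∑ xs f + d ≤ ∑ xs g
∑-mono-gap {xs = y ∷ ys} {f} {g} d f≤g (here refl) gap =
  subst (_≤ g y + ∑ ys g)
    (solve 3 (λ a b c → (a :+ b) :+ c := (a :+ c) :+ b) refl (f y) d (∑ ys f))
    (+-mono-≤ gap (∑-mono ys (λ _ → f≤g _)))
  where open +-*-Solver
∑-mono-gap {xs = y ∷ ys} {f} {g} d f≤g (there p) gap =
  subst (_≤ g y + ∑ ys g) (sym (+-assoc (f y) (∑ ys f) d)) (+-mono-≤ (f≤g y) (∑-mono-gap d f≤g p gap))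

bit : Bool → ℕ
bit false = 0
bit true  = 1

𝟙 : {P : Set} → Dec P → ℕ
𝟙 P? = bit (does P?)

𝟙-yes : {P : Set} (P? : Dec P) → P → 𝟙 P? ≡ 1
𝟙-yes P? p rewrite dec-true P? p = refl

𝟙-no : {P : Set} (P? : Dec P) → ¬ P → 𝟙 P? ≡ 0
𝟙-no P? ¬p rewrite dec-false P? ¬p = refl

𝟙-mono : {P Q : Set} (P? : Dec P) (Q? : Dec Q) → (P → Q) → 𝟙 P? ≤ 𝟙 Q?
𝟙-mono (yes p) Q? P⇒Q = ≤-reflexive (sym (𝟙-yes Q? (P⇒Q p)))
𝟙-mono (no _)  Q? P⇒Q = z≤n

∑-𝟙-unique : ∀ {A : Set} {P : A → Set} (P? : ∀ x → Dec (P x)) {xs} → Unique xs →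
  (∀ {x y} → P x → P y → x ≡ y) → ∑ xs (𝟙 ∘ P?) ≤ 1
∑-𝟙-unique P? []  P! = z≤n
∑-𝟙-unique P? {x ∷ xs} (x∉ ∷ xs!) P! with P? x
... | no _  = ∑-𝟙-unique P? xs! P!
... | yes p = s≤s (≤-trans
  (∑-mono xs {g = λ _ → 0} λ {y} y∈ → ≤-reflexive (𝟙-no (P? y) λ q → All.lookup x∉ y∈ (P! p q)))
  (≤-reflexive (∑-zero xs)))

-- The tail of `allFin (suc m)` is `tabulate suc` and not `allFin m`, so the induction runs over
-- `tabulate ι` for arbitrary `ι`.
∣∣≡∑-tabulate : ∀ {m n} (p : Subset m) (ι : Fin m → Fin n) {f : Fin n → ℕ} →
  (∀ j → f (ι j) ≡ 𝟙 (j ∈? p)) → ∑ (tabulate ι) f ≡ ∣ p ∣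
∣∣≡∑-tabulate []            ι eq = refl
∣∣≡∑-tabulate (inside ∷ p)  ι eq = cong₂ _+_ (eq zero) (∣∣≡∑-tabulate p (ι ∘ suc) (eq ∘ suc))
∣∣≡∑-tabulate (outside ∷ p) ι eq = cong₂ _+_ (eq zero) (∣∣≡∑-tabulate p (ι ∘ suc) (eq ∘ suc))

∣∣≡∑ : ∀ {n} (p : Subset n) → ∑ (allFin n) (λ v → 𝟙 (v ∈? p)) ≡ ∣ p ∣
∣∣≡∑ p = ∣∣≡∑-tabulate p id λ _ → refl

-- Double counting of the pairs of equal entries: each entry of `xs` has a partner in `ys`, and each
-- entry of `ys` has at most one in the repetition-free `xs`.
length-mono-⊆ : ∀ {A : Set} → (∀ (x y : A) → Dec (x ≡ y)) → {xs ys : List A} → Unique xs →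
  (∀ {x} → x ∈ˡ xs → x ∈ˡ ys) → length xs ≤ length ys
length-mono-⊆ _≟_ {xs} {ys} xs! xs⊆ys = begin
  length xs                               ≡⟨ ∑-one xs ⟨
  ∑ xs (λ _ → 1)
      ≤⟨ ∑-mono xs (λ {x} x∈ → ≤-trans (≤-reflexive (sym (𝟙-yes (x ≟ x) refl)))
      (∈⇒≤∑ (λ y → 𝟙 (x ≟ y)) (xs⊆ys x∈))) ⟩
  ∑ xs (λ x → ∑ ys (λ y → 𝟙 (x ≟ y)))     ≡⟨ ∑-comm xs ys _ ⟩
  ∑ ys (λ y → ∑ xs (λ x → 𝟙 (x ≟ y)))     ≤⟨ ∑-mono ys (λ {y} _ → ∑-𝟙-unique (_≟ y) xs! (λ p q → trans p (sym q))) ⟩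
  ∑ ys (λ _ → 1)                          ≡⟨ ∑-one ys ⟩
  length ys                               ∎
  where open ≤-Reasoning

-- Subsets of a finite set: enumeration and comprehension.

_≟ˢ_ : ∀ {n} (S T : Subset n) → Dec (S ≡ T)
_≟ˢ_ = Vec.≡-dec Bool._≟_

subsets : ∀ n → List (Subset n)
subsets zero    = [] ∷ []
subsets (suc n) = map (inside ∷_) (subsets n) ++ map (outside ∷_) (subsets n)

∈-subsets : ∀ {n} (S : Subset n) → S ∈ˡ subsets n
∈-subsets []            = here refl
∈-subsets (inside ∷ S)  = ∈-++⁺ˡ (∈-map⁺ _ (∈-subsets S))
∈-subsets (outside ∷ S) = ∈-++⁺ʳ _ (∈-map⁺ _ (∈-subsets S))

subsets! : ∀ n → Unique (subsets n)
subsets! zero    = [] ∷ []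
subsets! (suc n) = Unique.++⁺ (Unique.map⁺ Vec.∷-injectiveʳ (subsets! n)) (Unique.map⁺ Vec.∷-injectiveʳ (subsets! n))
  λ (p , q) → case (∈-map⁻ _ p) (∈-map⁻ _ q)
  where
  case : ∀ {S} → ∃[ T ] (T ∈ˡ subsets n × S ≡ inside ∷ T) → ∃[ T ] (T ∈ˡ subsets n × S ≡ outside ∷ T) → _
  case (_ , _ , refl) (_ , _ , ())

∈-comprehension⁺ : ∀ {n} {P : Fin n → Set} (P? : ∀ v → Dec (P v)) {v} → P v → v ∈ comprehension P?
∈-comprehension⁺ P? {v} p = Vec.lookup⇒[]= v _ (trans (Vec.lookup∘tabulate (does ∘ P?) v) (dec-true (P? v) p))

∈-comprehension⁻ : ∀ {n} {P : Fin n → Set} (P? : ∀ v → Dec (P v)) {v} → v ∈ comprehension P? → P v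
∈-comprehension⁻ P? {v} v∈ = decidable-stable (P? v) λ ¬p →
  contradiction (trans (sym (Vec.[]=⇒lookup v∈)) (trans (Vec.lookup∘tabulate (does ∘ P?) v) (dec-false (P? v) ¬p))) λ ()

-- The weights 2 ^ (d + 1) - 1.

weight : ℕ → ℕ
weight zero    = 1
weight (suc d) = suc (2 * weight d)

suc-weight : ∀ d → suc (weight d) ≡ 2 ^ suc d
suc-weight zero    = refl
suc-weight (suc d) = trans
  (solve 1 (λ w → con 2 :+ con 2 :* w := con 2 :* (con 1 :+ w)) refl (weight d))
  (cong (2 *_) (suc-weight d))
  where open +-*-Solver

-- Each step up doubles the weight and adds 1, while the factor `k + 2` grows by 1 only, hence at
-- most doubles. The base case is the recursion of `weight` itself.
weight-+ : ∀ k d → suc (suc k) * weight d + 1 ≤ weight (suc k + d)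
weight-+ zero    d = ≤-reflexive (+-comm (2 * weight d) 1)
weight-+ (suc k) d = begin
  suc (suc (suc k)) * weight d + 1        ≤⟨ +-monoˡ-≤ 1 (*-monoˡ-≤ (weight d) lem) ⟩
  2 * suc (suc k) * weight d + 1
      ≤⟨ +-monoˡ-≤ 1 (≤-trans (≤-reflexive (*-assoc 2 (suc (suc k)) (weight d)))
      (*-monoʳ-≤ 2 (≤-trans (m≤m+n _ 1) (weight-+ k d)))) ⟩
  2 * weight (suc k + d) + 1              ≡⟨ +-comm _ 1 ⟩
  weight (suc (suc k) + d)                ∎
  where
  open ≤-Reasoning
  lem : suc (suc (suc k)) ≤ 2 * suc (suc k)
  lem = subst (3 + k ≤_) (solve 1 (λ k → (con 3 :+ k) :+ (con 1 :+ k) := con 2 :* (con 2 :+ k)) refl k) (m≤m+n _ _)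
    where open +-*-Solver

weight-mono : ∀ {d e} → d ≤ e → weight d ≤ weight e
weight-mono {e = zero}  z≤n = ≤-refl
weight-mono {e = suc e} z≤n = s≤s z≤n
weight-mono (s≤s d≤e)       = s≤s (*-monoʳ-≤ 2 (weight-mono d≤e))

-- This is `weight-+` at distance `s ∸ p`, a successor because `p < s`. In the count, `s`, `p` and
-- `q` are the sizes of a set, of a predecessor of it and of an origin no larger than that
-- predecessor: the weight of the origin pays for one regular copy of the weight of the set, `s ∸ p`
-- further copies, and 1.
weight-gap : ∀ {B s p q} → q ≤ p → p < s → s ≤ B → suc (s ∸ p) * weight (B ∸ s) + 1 ≤ weight (B ∸ q)
weight-gap {B} {s} {p} {q} q≤p p<s s≤B = begin
  suc (s ∸ p) * weight (B ∸ s) + 1                 ≡⟨ cong (λ k → suc k * weight (B ∸ s) + 1) (sym (suc-pred-gap)) ⟩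
  suc (suc (s ∸ suc p)) * weight (B ∸ s) + 1       ≤⟨ weight-+ (s ∸ suc p) (B ∸ s) ⟩
  weight (suc (s ∸ suc p) + (B ∸ s))               ≡⟨ cong (λ k → weight (k + (B ∸ s))) suc-pred-gap ⟩
  weight ((s ∸ p) + (B ∸ s))                       ≤⟨ weight-mono (≤-trans (≤-reflexive gap) (∸-monoʳ-≤ B q≤p)) ⟩
  weight (B ∸ q)                                   ∎
  where
  open ≤-Reasoning
  suc-pred-gap : suc (s ∸ suc p) ≡ s ∸ p
  suc-pred-gap = sym (+-∸-assoc 1 p<s)
  gap : (s ∸ p) + (B ∸ s) ≡ B ∸ p
  gap = trans (+-comm (s ∸ p) (B ∸ s)) (trans (sym (+-∸-assoc (B ∸ s) (<⇒≤ p<s))) (cong (_∸ p) (m∸n+n≡m s≤B)))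

-- Predecessors, hats and witnesses in an IS-family.

module Family {c n : ℕ} {𝓕 : SetFamily n} (I : IsISFamily c 𝓕) where
  open SetFamily 𝓕
  open Notions 𝓕
  open IsISFamily I
  open EC ec
  open IsStrictPartialOrder isStrictPartialOrder using () renaming (trans to ≺-trans)

  ≺⇒< : ∀ {S T} → S ≺ T → ∣ S ∣ < ∣ T ∣
  ≺⇒< S≺T = SM (proj₁ (≺⇒𝐅 S≺T)) (proj₂ (≺⇒𝐅 S≺T)) S≺T

  sm∈𝐅 : 𝐅 sm
  sm∈𝐅 = proj₁ (proj₁ (proj₂ SE))

  -- (SW) identifies every witness with the answer of the procedure.
  witness-complete : ∀ {S v W} → 𝐅 S → v ∈ S → IsWitness S v W → witness S v ≡ just W
  witness-complete {S} {v} {W} S∈ v∈ w with witness S v | witness-correct S∈ v∈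
  ... | just W′ | w′ = cong just (SW S∈ v∈ w′ w)
  ... | nothing | ¬w = contradiction (W , w) ¬w

  -- Climb from `T` towards `S` while some member lies strictly between; by (SM) the gap in size
  -- shrinks at each step.
  pred-above : ∀ {S T} → T ≺ S → ∃[ P ] (IsPred S P × (T ≡ P ⊎ T ≺ P))
  pred-above {S} = λ T≺S → go (<-wellFounded _) T≺S
    where
    go : ∀ {T} → Acc _<_ (∣ S ∣ ∸ ∣ T ∣) → T ≺ S → ∃[ P ] (IsPred S P × (T ≡ P ⊎ T ≺ P))
    go {T} (acc rec) T≺S with anySubset? (λ T′ → 𝐅? T′ ×-dec T ≺? T′ ×-dec T′ ≺? S)
    ... | no  ¬∃ = T , (proj₁ (≺⇒𝐅 T≺S) , T≺S , ¬∃) , inj₁ refl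
    ... | yes (T′ , _ , T≺T′ , T′≺S) with go (rec (∸-monoʳ-< (≺⇒< T≺T′) (<⇒≤ (≺⇒< T′≺S)))) T′≺S
    ...   | P , isP , inj₁ refl = P , isP , inj₂ T≺T′
    ...   | P , isP , inj₂ T′≺P = P , isP , inj₂ (≺-trans T≺T′ T′≺P)

  -- Descend while a smaller member contains `v`; where the descent stops, `v` lies in the hat.
  minimal-containing : ∀ {S v} → 𝐅 S → v ∈ S → ∃[ T ] (𝐅 T × InHat T v × (T ≡ S ⊎ T ≺ S))
  minimal-containing {S} {v} = λ S∈ v∈ → go (<-wellFounded _) S∈ v∈
    where
    go : ∀ {S} → Acc _<_ ∣ S ∣ → 𝐅 S → v ∈ S → ∃[ T ] (𝐅 T × InHat T v × (T ≡ S ⊎ T ≺ S))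
    go {S} (acc rec) S∈ v∈ with anySubset? (λ T → 𝐅? T ×-dec T ≺? S ×-dec v ∈? T)
    ... | no  ¬∃ = S , S∈ , (v∈ , ¬∃) , inj₁ refl
    ... | yes (T , T∈ , T≺S , v∈T) with go (rec (≺⇒< T≺S)) T∈ v∈T
    ...   | M , M∈ , h , inj₁ refl = M , M∈ , h , inj₂ T≺S
    ...   | M , M∈ , h , inj₂ M≺T  = M , M∈ , h , inj₂ (≺-trans M≺T T≺S)

  -- Evidence that `S` is the witness of a hat vertex of another set. `pred` is retained because
  -- (LVS) is applied to it, and `origin≤pred` lets the weight of the origin pay for the gap in size
  -- between `pred` and `S`.
  record Source (S : Subset n) (v : Fin n) : Set where
    field
      origin      : Subset n
      origin∈𝐅    : 𝐅 origin
      inHat       : InHat origin v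
      isWitness   : IsWitness origin v S
      pred        : Subset n
      isPred      : IsPred S pred
      origin≤pred : ∣ origin ∣ ≤ ∣ pred ∣

  visible⇒source : ∀ {S v} → Visible S v → v ∉ S → Source S v
  visible⇒source {S} {v} ((P , P∈Pred@(P∈ , P≺S , _) , v∈P) , uncovered) v∉S
    with minimal-containing P∈ v∈P
  ... | T , T∈ , hat@(v∈T , _) , T⪯P = record
    { origin      = T
    ; origin∈𝐅    = T∈
    ; inHat       = hat
    ; isWitness   = (proj₂ (≺⇒𝐅 P≺S) , T≺S T⪯P , v∈T , v∉S) , minimal
    ; pred        = P
    ; isPred      = P∈Pred
    ; origin≤pred = ∣T∣≤ T⪯P
    }
    where
    T≺S : T ≡ P ⊎ T ≺ P → T ≺ S
    T≺S (inj₁ refl) = P≺S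
    T≺S (inj₂ T≺P)  = ≺-trans T≺P P≺S
    ∣T∣≤ : T ≡ P ⊎ T ≺ P → ∣ T ∣ ≤ ∣ P ∣
    ∣T∣≤ (inj₁ refl) = ≤-refl
    ∣T∣≤ (inj₂ T≺P)  = <⇒≤ (≺⇒< T≺P)
    -- A set `R` that drops `v` before `S` lies below or at a predecessor of `S`. By (TE) `v` is
    -- missing from that predecessor too, which therefore covers `v`, contrary to visibility.
    minimal : ¬ (∃[ R ] (Drops T v R × R ≺ S))
    minimal (R , (R∈ , T≺R , _ , v∉R) , R≺S) with pred-above R≺S
    ... | R , isP , inj₁ refl = uncovered (R , isP , T , T∈ , T≺R , v∈T , v∉R)
    ... | Q , isP , inj₂ R≺Q  = uncovered (Q , isP , T , T∈ , ≺-trans T≺R R≺Q , v∈T ,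
      proj₂ (TE T∈ R∈ (proj₂ (≺⇒𝐅 R≺Q)) T≺R R≺Q (v∈T , v∉R)))

  -- (DVS) only refutes an inclusion; a search through the finite ground set extracts the vertex.
  dropped-visible : ∀ {S} → 𝐅 S → S ≢ sm → ∃[ v ] (Visible S v × v ∉ S)
  dropped-visible {S} S∈ S≢sm with Fin.any? (λ v → visible? S v ×-dec ¬? (v ∈? S))
  ... | yes p = p
  ... | no ¬p = contradiction
    (λ {v} v∈Vis → decidable-stable (v ∈? S) λ v∉S → ¬p (v , ∈-comprehension⁻ (visible? S) v∈Vis , v∉S))
    (DVS S∈ S≢sm)

  -- Sets of excess at most `x`: their number and their generation by witnesses.

  module Excess (x : ℕ) where

    sizeBound : ℕ
    sizeBound = ∣ sm ∣ + x

    Small : Subset n → Set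
    Small S = 𝐅 S × ∣ S ∣ ≤ sizeBound

    sm-small : Small sm
    sm-small = sm∈𝐅 , m≤m+n ∣ sm ∣ x

    private
      proper? : ∀ S → Dec (Small S × S ≢ sm)
      proper? S = (𝐅? S ×-dec ∣ S ∣ ≤? sizeBound) ×-dec ¬? (S ≟ˢ sm)

      E E′ : List (Subset n)
      E′ = filter proper? (subsets n)
      E  = sm ∷ E′

      V : List (Fin n)
      V = allFin n

      small⇒∈E : ∀ {S} → Small S → S ∈ˡ E
      small⇒∈E {S} S-small with S ≟ˢ sm
      ... | yes refl = here refl
      ... | no S≢sm  = there (∈-filter⁺ proper? (∈-subsets S) (S-small , S≢sm))

      E′! : Unique E′
      E′! = Unique.filter⁺ proper? (subsets! n)

      wt : Subset n → ℕ
      wt S = weight (sizeBound ∸ ∣ S ∣)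

      _≟ᴹ_ : (w w′ : Maybe (Subset n)) → Dec (w ≡ w′)
      _≟ᴹ_ = Maybe.≡-dec _≟ˢ_

      flow? : ∀ T v S → Dec (InHat T v × witness T v ≡ just S)
      flow? T v S = inHat? T v ×-dec (witness T v ≟ᴹ just S)

      -- Senders range over all of `E`, `sm` included, whereas only members of `E′` are counted as
      -- receivers.
      inflow : Subset n → Fin n → ℕ
      inflow S v = ∑ E (λ T → 𝟙 (flow? T v S) * wt T)

      dropped? : ∀ S v → Dec (Visible S v × v ∉ S)
      dropped? S v = visible? S v ×-dec ¬? (v ∈? S)

      #dropped : Subset n → ℕ
      #dropped S = ∑ V (𝟙 ∘ dropped? S)

      ∣comprehension∣ : ∀ {P : Fin n → Set} (P? : ∀ v → Dec (P v)) → ∑ V (𝟙 ∘ P?) ≡ ∣ comprehension P? ∣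
      ∣comprehension∣ P? = trans
        (∑-cong V λ v → ≤-antisym
          (𝟙-mono (P? v) (v ∈? comprehension P?) (∈-comprehension⁺ P?))
          (𝟙-mono (v ∈? comprehension P?) (P? v) (∈-comprehension⁻ P?)))
        (∣∣≡∑ (comprehension P?))

      -- Vertex by vertex: a hat vertex lies in no predecessor and so is not visible, and a visible
      -- vertex is either in `S` or dropped.
      ∣hat∣+∣Vis∣≤ : ∀ S → ∣ hat S ∣ + ∣ Vis S ∣ ≤ ∣ S ∣ + #dropped S
      ∣hat∣+∣Vis∣≤ S = begin
        ∣ hat S ∣ + ∣ Vis S ∣
          ≡⟨ cong₂ _+_ (∣comprehension∣ (inHat? S)) (∣comprehension∣ (visible? S)) ⟨
        ∑ V (𝟙 ∘ inHat? S) + ∑ V (𝟙 ∘ visible? S)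
          ≡⟨ ∑-distrib-+ V ⟨
        ∑ V (λ v → 𝟙 (inHat? S v) + 𝟙 (visible? S v))
          ≤⟨ ∑-mono V (λ {v} _ → pointwise v (inHat? S v) (visible? S v)) ⟩
        ∑ V (λ v → 𝟙 (v ∈? S) + 𝟙 (dropped? S v))
          ≡⟨ ∑-distrib-+ V ⟩
        ∑ V (λ v → 𝟙 (v ∈? S)) + #dropped S
          ≡⟨ cong (_+ #dropped S) (∣∣≡∑ S) ⟩
        ∣ S ∣ + #dropped S ∎
        where
        open ≤-Reasoning
        pointwise : ∀ v (h : Dec (InHat S v)) (w : Dec (Visible S v)) →
          𝟙 h + 𝟙 w ≤ 𝟙 (v ∈? S) + 𝟙 (dropped? S v)
        pointwise v (yes (_ , new)) (yes ((P , (P∈ , P≺S , _) , v∈P) , _)) = contradiction (P , P∈ , P≺S , v∈P) new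
        pointwise v (yes (v∈S , _)) (no _) = ≤-trans (≤-reflexive (sym (𝟙-yes (v ∈? S) v∈S))) (m≤m+n _ _)
        pointwise v (no _) (no _) = z≤n
        pointwise v (no _) (yes vis) with v ∈? S
        ... | yes _  = s≤s z≤n
        ... | no v∉S = ≤-reflexive (sym (𝟙-yes (visible? S v ×-dec yes v∉S) (vis , v∉S)))

      -- The origin is smaller than `S`, hence itself a member of `E`, and its term alone gives the
      -- bound.
      source-inflow : ∀ {S v} → Small S → (src : Source S v) → wt (Source.origin src) ≤ inflow S v
      source-inflow {S} {v} (S∈ , S≤) src = begin
        wt origin                               ≡⟨ *-identityˡ (wt origin) ⟨
        1 * wt origin                           ≡⟨ cong (_* wt origin) (sym (𝟙-yes (flow? origin v S) flows)) ⟩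
        𝟙 (flow? origin v S) * wt origin        ≤⟨ ∈⇒≤∑ (λ T → 𝟙 (flow? T v S) * wt T) (small⇒∈E (origin∈𝐅 , origin≤)) ⟩
        inflow S v                              ∎
        where
        open ≤-Reasoning
        open Source src
        flows : InHat origin v × witness origin v ≡ just S
        flows = inHat , witness-complete origin∈𝐅 (proj₁ inHat) isWitness
        origin≤ : ∣ origin ∣ ≤ sizeBound
        origin≤ = ≤-trans (<⇒≤ (≺⇒< (proj₁ (proj₂ (proj₁ isWitness))))) S≤

      -- A single dropped vertex v₀ pays for the surplus |S| - |P|; the others pay for themselves.
      inflow-bound : ∀ {S} → Small S → S ≢ sm → ∣ hat S ∣ * wt S + 1 ≤ ∑ V (inflow S)
      inflow-bound {S} S-small@(S∈ , S≤) S≢sm with dropped-visible S∈ S≢sm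
      ... | v₀ , vis₀ , v₀∉S = begin
        ∣ hat S ∣ * wt S + 1                       ≤⟨ +-monoˡ-≤ 1 (*-monoˡ-≤ (wt S) hat≤) ⟩
        (#dropped S + k) * wt S + 1                ≡⟨ cong (_+ 1) (*-distribʳ-+ (wt S) (#dropped S) k) ⟩
        #dropped S * wt S + k * wt S + 1           ≡⟨ +-assoc (#dropped S * wt S) _ 1 ⟩
        #dropped S * wt S + (k * wt S + 1)         ≡⟨ cong (_+ (k * wt S + 1)) (*-distribʳ-∑ V (wt S)) ⟨
        ∑ V (λ v → 𝟙 (dropped? S v) * wt S) + (k * wt S + 1)
                                                   ≤⟨ ∑-mono-gap (k * wt S + 1) (pointwise ∘ dropped? S) (∈-allFin v₀) at-v₀ ⟩
        ∑ V (inflow S)                             ∎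
        where
        open ≤-Reasoning
        src₀ : Source S v₀
        src₀ = visible⇒source vis₀ v₀∉S
        open Source src₀
        pred<S : ∣ pred ∣ < ∣ S ∣
        pred<S = ≺⇒< (proj₁ (proj₂ isPred))
        k : ℕ
        k = ∣ S ∣ ∸ ∣ pred ∣
        -- (LVS) is applied to the predecessor that comes with `v₀`, the one whose gap `k` is paid
        -- for at `v₀`.
        hat≤ : ∣ hat S ∣ ≤ #dropped S + k
        hat≤ = +-cancelʳ-≤ ∣ pred ∣ _ _ (begin
          ∣ hat S ∣ + ∣ pred ∣              ≤⟨ +-monoʳ-≤ ∣ hat S ∣ (LVS S∈ isPred) ⟩
          ∣ hat S ∣ + ∣ Vis S ∣             ≤⟨ ∣hat∣+∣Vis∣≤ S ⟩
          ∣ S ∣ + #dropped S                ≡⟨ +-comm ∣ S ∣ _ ⟩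
          #dropped S + ∣ S ∣                ≡⟨ cong (#dropped S +_) (m∸n+n≡m (<⇒≤ pred<S)) ⟨
          #dropped S + (k + ∣ pred ∣)       ≡⟨ +-assoc (#dropped S) k _ ⟨
          #dropped S + k + ∣ pred ∣         ∎)
        pointwise : ∀ {v} (d : Dec (Visible S v × v ∉ S)) → 𝟙 d * wt S ≤ inflow S v
        pointwise (no _) = z≤n
        pointwise (yes (vis , v∉S)) = ≤-trans (≤-reflexive (*-identityˡ (wt S)))
          (≤-trans (weight-mono (∸-monoʳ-≤ sizeBound (<⇒≤ (≺⇒< (proj₁ (proj₂ (proj₁ (Source.isWitness src))))))))
            (source-inflow S-small src))
          where src = visible⇒source vis v∉S
        at-v₀ : 𝟙 (dropped? S v₀) * wt S + (k * wt S + 1) ≤ inflow S v₀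
        at-v₀ = begin
          𝟙 (dropped? S v₀) * wt S + (k * wt S + 1)
              ≡⟨ cong (λ i → i * wt S + (k * wt S + 1)) (𝟙-yes (dropped? S v₀) (vis₀ , v₀∉S)) ⟩
          1 * wt S + (k * wt S + 1)                  ≡⟨ +-assoc (1 * wt S) _ 1 ⟨
          1 * wt S + k * wt S + 1                    ≡⟨ cong (_+ 1) (*-distribʳ-+ (wt S) 1 k) ⟨
          -- One copy of the weight is the share of `v₀` among the dropped vertices; the other `k`
          -- copies and the 1 are the surplus.
          suc k * wt S + 1                           ≤⟨ weight-gap origin≤pred pred<S S≤ ⟩
          wt origin                                  ≤⟨ source-inflow S-small src₀ ⟩
          inflow S v₀                                ∎

      -- After exchanging the sums, a pair `(T , v)` contributes to at most one receiver, since
      -- `witness` is a function.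
      outflow-bound : ∑ E′ (λ S → ∑ V (inflow S)) ≤ ∑ E (λ T → ∣ hat T ∣ * wt T)
      outflow-bound = begin
        ∑ E′ (λ S → ∑ V (λ v → ∑ E (λ T → 𝟙 (flow? T v S) * wt T)))
          ≡⟨ ∑-cong E′ (λ S → ∑-comm V E _) ⟩
        ∑ E′ (λ S → ∑ E (λ T → ∑ V (λ v → 𝟙 (flow? T v S) * wt T)))
          ≡⟨ ∑-comm E′ E _ ⟩
        ∑ E (λ T → ∑ E′ (λ S → ∑ V (λ v → 𝟙 (flow? T v S) * wt T)))
          ≡⟨ ∑-cong E (λ T → ∑-comm E′ V _) ⟩
        ∑ E (λ T → ∑ V (λ v → ∑ E′ (λ S → 𝟙 (flow? T v S) * wt T)))
          ≡⟨ ∑-cong E (λ T → ∑-cong V λ v → *-distribʳ-∑ E′ (wt T)) ⟩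
        ∑ E (λ T → ∑ V (λ v → ∑ E′ (λ S → 𝟙 (flow? T v S)) * wt T))
          ≤⟨ ∑-mono E (λ {T} _ → ∑-mono V λ {v} _ → *-monoˡ-≤ (wt T) (single T v (inHat? T v))) ⟩
        ∑ E (λ T → ∑ V (λ v → 𝟙 (inHat? T v) * wt T))
          ≡⟨ ∑-cong E (λ T → trans (*-distribʳ-∑ V (wt T)) (cong (_* wt T) (∣comprehension∣ (inHat? T)))) ⟩
        ∑ E (λ T → ∣ hat T ∣ * wt T) ∎
        where
        open ≤-Reasoning
        single : ∀ T v (h : Dec (InHat T v)) → ∑ E′ (λ S → 𝟙 (h ×-dec (witness T v ≟ᴹ just S))) ≤ 𝟙 h
        single T v (no _)  = ≤-reflexive (∑-zero E′)
        single T v (yes h) = ∑-𝟙-unique (λ S → yes h ×-dec (witness T v ≟ᴹ just S)) E′!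
          λ (_ , p) (_ , q) → Maybe.just-injective (trans (sym p) q)

      -- What the sets of `E′` send out stands on both sides and cancels. Each of them leaves a 1 on
      -- the left; on the right only the pairs of `sm` remain, of weight `weight x` each because
      -- `sizeBound` exceeds the size of `sm` by `x`.
      length-E′ : length E′ ≤ ∣ sm ∣ * weight x
      length-E′ = +-cancelˡ-≤ total _ _ (begin
        total + length E′                         ≡⟨ cong (total +_) (∑-one E′) ⟨
        total + ∑ E′ (λ _ → 1)                    ≡⟨ ∑-distrib-+ E′ ⟨
        ∑ E′ (λ S → ∣ hat S ∣ * wt S + 1)
          ≤⟨ ∑-mono E′ (λ S∈ → let (_ , small , ≢sm) = ∈-filter⁻ proper? {xs = subsets n} S∈ in inflow-bound small ≢sm) ⟩
        ∑ E′ (λ S → ∑ V (inflow S))               ≤⟨ outflow-bound ⟩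
        ∣ hat sm ∣ * wt sm + total
          ≤⟨ +-monoˡ-≤ total (*-mono-≤ ∣hat∣≤ (≤-reflexive (cong weight (m+n∸m≡n ∣ sm ∣ x)))) ⟩
        ∣ sm ∣ * weight x + total                 ≡⟨ +-comm _ total ⟩
        total + ∣ sm ∣ * weight x                 ∎)
        where
        open ≤-Reasoning
        total : ℕ
        total = ∑ E′ (λ S → ∣ hat S ∣ * wt S)
        ∣hat∣≤ : ∣ hat sm ∣ ≤ ∣ sm ∣
        ∣hat∣≤ = begin
          ∣ hat sm ∣                     ≡⟨ ∣comprehension∣ (inHat? sm) ⟨
          ∑ V (𝟙 ∘ inHat? sm)            ≤⟨ ∑-mono V (λ {v} _ → 𝟙-mono (inHat? sm v) (v ∈? sm) proj₁) ⟩
          ∑ V (λ v → 𝟙 (v ∈? sm))        ≡⟨ ∣∣≡∑ sm ⟩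
          ∣ sm ∣                         ∎

    -- The maximum with 1 caters for an empty `sm`, which still counts as one set.
    countBound : ℕ
    countBound = (1 ⊔ ∣ sm ∣) * 2 ^ suc x

    small-count : ∀ {Ss} → Unique Ss → All Small Ss → length Ss ≤ countBound
    small-count {Ss} Ss! Ss-small = begin
      length Ss                          ≤⟨ length-mono-⊆ _≟ˢ_ Ss! (λ S∈ → small⇒∈E (All.lookup Ss-small S∈)) ⟩
      suc (length E′)                    ≤⟨ s≤s length-E′ ⟩
      1 + ∣ sm ∣ * weight x              ≤⟨ +-mono-≤ (m≤m⊔n 1 ∣ sm ∣) (*-monoˡ-≤ (weight x) (m≤n⊔m 1 ∣ sm ∣)) ⟩
      r + r * weight x                   ≡⟨ *-suc r (weight x) ⟨
      r * suc (weight x)                 ≡⟨ cong (r *_) (suc-weight x) ⟩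
      countBound                         ∎
      where
      open ≤-Reasoning
      r : ℕ
      r = 1 ⊔ ∣ sm ∣

    -- Induction on the size: a set other than `sm` is a witness with respect to a strictly smaller
    -- origin, which is listed already.
    closed⇒complete : ∀ {Ss} → sm ∈ˡ Ss →
      (∀ {S v W} → S ∈ˡ Ss → v ∈ S → witness S v ≡ just W → ∣ W ∣ ≤ sizeBound → W ∈ˡ Ss) →
      ∀ {S} → Small S → S ∈ˡ Ss
    closed⇒complete {Ss} sm∈ closed S-small = go (<-wellFounded _) S-small
      where
      go : ∀ {S} → Acc _<_ ∣ S ∣ → Small S → S ∈ˡ Ss
      go {S} (acc rec) (S∈ , S≤) with S ≟ˢ sm
      ... | yes refl = sm∈
      ... | no S≢sm with dropped-visible S∈ S≢sm
      ...   | v , vis , v∉S = closed (go (rec origin<S) (origin∈𝐅 , ≤-trans (<⇒≤ origin<S) S≤)) (proj₁ inHat)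
        (witness-complete origin∈𝐅 (proj₁ inHat) isWitness) S≤
        where
        open Source (visible⇒source vis v∉S)
        origin<S : ∣ origin ∣ < ∣ S ∣
        origin<S = ≺⇒< (proj₁ (proj₂ (proj₁ isWitness)))

-- The search and filter program.

-- A holds the sets found so far and Q those among them whose witnesses are still to be
-- computed.  B holds |sm| + x + 1 in unary, so that a set fits iff B outlasts it.

out B D Y Z U OK W T V S Q A : Fin 13
out = # 0
B   = # 1
D   = # 2
Y   = # 3
Z   = # 4
U   = # 5
OK  = # 6
W   = # 7
T   = # 8
V   = # 9
S   = # 10
Q   = # 11
A   = # 12

`true : ∀ {k} → Expr k
`true = `cons `nil `nil

countLoop measureLoop compareLoop memberLoop insert visit visitLoop searchLoop : Cmd 13

countLoop = while var T loop
  ((if `hd (var T) then B ≔ `cons `nil (var B) else skip) ⨾ T ≔ `tl (var T))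

measureLoop = while var U loop
  ((if `hd (var U) then Y ≔ `tl (var Y) else skip) ⨾ U ≔ `tl (var U))

compareLoop = while var Z loop
  ( (if `hd (var Y) then (if `hd (var Z) then skip else (D ≔ `true))
     else (if `hd (var Z) then D ≔ `true else skip))
  ⨾ Y ≔ `tl (var Y) ⨾ Z ≔ `tl (var Z))

-- `OK` is true on entry and cleared by a match, so at the end it means absence; `compareLoop` makes
-- `D` true exactly if the two sets differ.
memberLoop = while var U loop
  ( Y ≔ `hd (var U) ⨾ Z ≔ var W ⨾ compareLoop
  ⨾ (if var D then skip else (OK ≔ `nil)) ⨾ D ≔ `nil ⨾ U ≔ `tl (var U))

insert =
  (Y ≔ var B ⨾ U ≔ var W ⨾ measureLoop) ⨾
  (if var Y then
    ( (Y ≔ `nil ⨾ OK ≔ `true ⨾ U ≔ var A ⨾ memberLoop)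
    ⨾ (if var OK then (A ≔ `cons (var W) (var A) ⨾ Q ≔ `cons (var W) (var Q) ⨾ OK ≔ `nil) else skip))
   else skip)

visit = W ≔witness var S , var V ⨾
  (if var W then (W ≔ `hd (var W) ⨾ insert ⨾ W ≔ `nil) else skip)

-- `V` counts in unary the position of the bit at the head of `T`, which is the encoding of a vertex
-- that the witness procedure expects.
visitLoop = while var T loop
  ((if `hd (var T) then visit else skip) ⨾ V ≔ `cons `nil (var V) ⨾ T ≔ `tl (var T))

searchLoop = while var Q loop
  ( (S ≔ `hd (var Q) ⨾ Q ≔ `tl (var Q) ⨾ T ≔ var S)
  ⨾ visitLoop ⨾ V ≔ `nil ⨾ S ≔ `nil)

subtractLoop restoreLoop peelLoop inhabitedLoop select filterLoop program : Cmd 13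

-- The bits of the difference are consed onto `D` and come out reversed; `restoreLoop` reverses them
-- back into `Z`.
subtractLoop = while var Y loop
  ( (if `hd (var Y) then D ≔ `cons `nil (var D) else (D ≔ `cons (`hd (var Z)) (var D)))
  ⨾ Y ≔ `tl (var Y) ⨾ Z ≔ `tl (var Z))

restoreLoop = while var D loop (Z ≔ `cons (`hd (var D)) (var Z) ⨾ D ≔ `tl (var D))

peelLoop = while var T loop
  ( W ≔precedes `hd (var T) , var S
  ⨾ (if var W then (Y ≔ `hd (var T) ⨾ subtractLoop ⨾ restoreLoop) else skip)
  ⨾ W ≔ `nil ⨾ T ≔ `tl (var T))

inhabitedLoop = while var Z loop
  ((if `hd (var Z) then OK ≔ `true else skip) ⨾ Z ≔ `tl (var Z))

select =
  (S ≔ `hd (var U) ⨾ Z ≔ var S ⨾ T ≔ var A)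
  ⨾ peelLoop ⨾ inhabitedLoop
  ⨾ (if var OK then out ≔ `cons (var S) (var out) else skip)
  ⨾ OK ≔ `nil ⨾ S ≔ `nil ⨾ U ≔ `tl (var U)

filterLoop = while var U loop select

program =
  -- The inputs `n` and `x` arrive in `out` and `B`. The first is discarded; the extra cell on `B`
  -- makes it one larger than `sizeBound` after `countLoop`, so that a set of exactly that size
  -- still fits.
  (S ≔sm ⨾ out ≔ `nil ⨾ B ≔ `cons `nil (var B) ⨾ T ≔ var S)
  ⨾ countLoop
  ⨾ (A ≔ `cons (var S) `nil ⨾ Q ≔ var A ⨾ S ≔ `nil)
  ⨾ searchLoop ⨾ U ≔ var A ⨾ filterLoop

-- Functions on bit vectors computed by the inner loops.

differs : ∀ {m} → Bool → Subset m → Subset m → Bool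
differs d []           []           = d
differs d (true ∷ p)   (true ∷ q)   = differs d p q
differs d (true ∷ p)   (false ∷ q)  = differs true p q
differs d (false ∷ p)  (true ∷ q)   = differs true p q
differs d (false ∷ p)  (false ∷ q)  = differs d p q

differs-true : ∀ {m} (p q : Subset m) → differs true p q ≡ true
differs-true []           []           = refl
differs-true (true ∷ p)   (true ∷ q)   = differs-true p q
differs-true (true ∷ p)   (false ∷ q)  = differs-true p q
differs-true (false ∷ p)  (true ∷ q)   = differs-true p q
differs-true (false ∷ p)  (false ∷ q)  = differs-true p q

differs-refl : ∀ {m} d (p : Subset m) → differs d p p ≡ d
differs-refl d []          = refl
differs-refl d (true ∷ p)  = differs-refl d p
differs-refl d (false ∷ p) = differs-refl d p

differs-≢ : ∀ {m} (p q : Subset m) → p ≢ q → differs false p q ≡ true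
differs-≢ []           []           p≢q = contradiction refl p≢q
differs-≢ (true ∷ p)   (true ∷ q)   p≢q = differs-≢ p q (p≢q ∘ cong (true ∷_))
differs-≢ (true ∷ p)   (false ∷ q)  p≢q = differs-true p q
differs-≢ (false ∷ p)  (true ∷ q)   p≢q = differs-true p q
differs-≢ (false ∷ p)  (false ∷ q)  p≢q = differs-≢ p q (p≢q ∘ cong (false ∷_))

inhabited : ∀ {m} → Bool → Subset m → Bool
inhabited k []          = k
inhabited k (true ∷ p)  = inhabited true p
inhabited k (false ∷ p) = inhabited k p

inhabited-true : ∀ {m} (p : Subset m) → inhabited true p ≡ true
inhabited-true []          = refl
inhabited-true (true ∷ p)  = inhabited-true p
inhabited-true (false ∷ p) = inhabited-true p

inhabited⁺ : ∀ {m} {p : Subset m} {v} → v ∈ p → inhabited false p ≡ true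
inhabited⁺ {p = true ∷ p}  {zero}  v∈                = inhabited-true p
inhabited⁺ {p = true ∷ p}  {suc v} (thereⱽ v∈) = inhabited-true p
inhabited⁺ {p = false ∷ p} {suc v} (thereⱽ v∈) = inhabited⁺ v∈

inhabited⁻ : ∀ {m} (p : Subset m) → inhabited false p ≡ true → Nonempty p
inhabited⁻ (true ∷ p)  eq = zero , hereⱽ
inhabited⁻ (false ∷ p) eq with inhabited⁻ p eq
... | v , v∈ = suc v , thereⱽ v∈

-- While one set is expanded, `A` and `Q` change only by pushing the same new sets onto both; the
-- invariants of the search follow from this.
data Grow {A : Set} (xs ys : List A) : List A → List A → Set where
  done : Grow xs ys xs ys
  push : ∀ {xs′ ys′} z → Grow xs ys xs′ ys′ → Grow xs ys (z ∷ xs′) (z ∷ ys′)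

Grow-trans : ∀ {A : Set} {xs ys xs′ ys′ xs″ ys″ : List A} →
  Grow xs ys xs′ ys′ → Grow xs′ ys′ xs″ ys″ → Grow xs ys xs″ ys″
Grow-trans g done       = g
Grow-trans g (push z h) = push z (Grow-trans g h)

module _ {A : Set} {xs ys : List A} where

  Grow-⊆ : ∀ {xs′ ys′ z} → Grow xs ys xs′ ys′ → z ∈ˡ xs → z ∈ˡ xs′
  Grow-⊆ done       z∈ = z∈
  Grow-⊆ (push _ g) z∈ = there (Grow-⊆ g z∈)

  Grow-⊇ʳ : ∀ {xs′ ys′ z} → Grow xs ys xs′ ys′ → z ∈ˡ ys → z ∈ˡ ys′
  Grow-⊇ʳ done       z∈ = z∈
  Grow-⊇ʳ (push _ g) z∈ = there (Grow-⊇ʳ g z∈)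

  Grow-new : ∀ {xs′ ys′ z} → Grow xs ys xs′ ys′ → z ∈ˡ xs′ → z ∈ˡ xs ⊎ z ∈ˡ ys′
  Grow-new done       z∈          = inj₁ z∈
  Grow-new (push _ g) (here refl) = inj₂ (here refl)
  Grow-new (push _ g) (there z∈) with Grow-new g z∈
  ... | inj₁ p = inj₁ p
  ... | inj₂ p = inj₂ (there p)

  Grow-queued : ∀ {xs′ ys′ z} → Grow xs ys xs′ ys′ → (z ∈ˡ ys → z ∈ˡ xs) → z ∈ˡ ys′ → z ∈ˡ xs′
  Grow-queued done       ⊆ z∈          = ⊆ z∈
  Grow-queued (push _ g) ⊆ (here refl) = here refl
  Grow-queued (push _ g) ⊆ (there z∈)  = there (Grow-queued g ⊆ z∈)

  -- Preserves the invariant that `A` is as long as `Q` together with the `p` sets taken from it so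
  -- far.
  Grow-length : ∀ {xs′ ys′ p} → Grow xs ys xs′ ys′ → p + length ys ≡ length xs → p + length ys′ ≡ length xs′
  Grow-length done eq = eq
  Grow-length {p = p} (push _ g) eq = trans (+-suc p _) (cong suc (Grow-length g eq))

-- Running times of the phases.

-- In the running times n is the size of the ground set, s bounds the size and l the number
-- of the listed sets.  A pass over a bit vector costs at most 20 per bit.

insertTime : ℕ → ℕ → ℕ
insertTime n l = (4 + (n * 20 + 2)) + (2 + ((8 + (l * (20 + n * 20) + 2)) + 12))

visitTime : ℕ → ℕ → ℕ → ℕ
visitTime c n l = (3 + c * n ^ 3) + (2 + (3 + (insertTime n l + 2)))

expandTime : ℕ → ℕ → ℕ → ℕ → ℕ
expandTime c n s l = 8 + ((s * visitTime c n l + (n * 20 + 2)) + 4)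

searchTime : ℕ → ℕ → ℕ → ℕ → ℕ
searchTime c n s l = l * (2 + expandTime c n s l) + 2

peelTime : ℕ → ℕ → ℕ
peelTime c n = (4 + c * n) + ((2 + (3 + ((n * 20 + 2) + (n * 20 + 2)))) + 5)

selectTime : ℕ → ℕ → ℕ → ℕ
selectTime c n l = 7 + ((l * (2 + peelTime c n) + 2) + ((n * 20 + 2) + 13))

filterTime : ℕ → ℕ → ℕ → ℕ
filterTime c n l = l * (2 + selectTime c n l) + 2

totalTime : ℕ → ℕ → ℕ → ℕ → ℕ
totalTime c n s l = ((1 + c * n ^ 3) + 8) + ((n * 20 + 2) + (8 + (searchTime c n s l + (2 + filterTime c n l))))

x∈p─q⇒x∉q : ∀ {m} (p q : Subset m) {v} → v ∈ p ─ q → v ∉ q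
x∈p─q⇒x∉q (_ ∷ p) (false ∷ q) (thereⱽ v∈) (thereⱽ v∈q) = x∈p─q⇒x∉q p q v∈ v∈q
x∈p─q⇒x∉q (_ ∷ p) (true ∷ q)  (thereⱽ v∈) (thereⱽ v∈q) = x∈p─q⇒x∉q p q v∈ v∈q

-- Executions with time bounds, and the loops over bit vectors.

module Runs {c n : ℕ} {𝓕 : SetFamily n} (I : IsISFamily c 𝓕) where
  open SetFamily 𝓕
  open Notions 𝓕
  open IsISFamily I
  open EC ec
  open Semantics I {13}
  open Family I

  infixr 4 _▸_

  -- Exact times vary with the branches taken and the procedure calls, so only an upper bound is
  -- carried; it is composed along the structure of the command.
  record Run (C : Cmd 13) (σ σ′ : Store 13) (t : ℕ) : Set where
    constructor run
    field
      {time}  : ℕ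
      exec    : Exec C σ σ′ time
      bounded : time ≤ t

  within : ∀ {C σ σ′ t t′} → t ≤ t′ → Run C σ σ′ t → Run C σ σ′ t′
  within t≤t′ (run e b) = run e (≤-trans b t≤t′)

  into : ∀ {C σ σ′ σ″ t} → σ′ ≡ σ″ → Run C σ σ′ t → Run C σ σ″ t
  into refl r = r

  within! : ∀ {C σ σ′ t t′} {p : Bool.T (t ≤ᵇ t′)} → Run C σ σ′ t → Run C σ σ′ t′
  within! {t = t} {t′} {p} = within (≤ᵇ⇒≤ t t′ p)

  set : ∀ {i e σ} → Run (i ≔ e) σ (σ [ i ]≔ eval e σ) (1 + cost e)
  set = run assign ≤-refl

  nop : ∀ {σ} → Run skip σ σ 1
  nop = run skip ≤-refl

  _▸_ : ∀ {C C′ σ σ′ σ″ t t′} → Run C σ σ′ t → Run C′ σ′ σ″ t′ → Run (C ⨾ C′) σ σ″ (t + t′)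
  run e b ▸ run e′ b′ = run (seq e e′) (+-mono-≤ b b′)

  true! : ∀ {e C C′ σ σ′ t} → eval e σ ≢ nil → Run C σ σ′ t → Run (if e then C else C′) σ σ′ (1 + cost e + t)
  true! {e} p (run x b) = run (if-true p x) (+-monoʳ-≤ (1 + cost e) b)

  false! : ∀ {e C C′ σ σ′ t} → eval e σ ≡ nil → Run C′ σ σ′ t → Run (if e then C else C′) σ σ′ (1 + cost e + t)
  false! {e} p (run x b) = run (if-false p x) (+-monoʳ-≤ (1 + cost e) b)

  stop : ∀ {e C σ} → eval e σ ≡ nil → Run (while e loop C) σ σ (1 + cost e)
  stop p = run (while-false p) ≤-refl

  again : ∀ {e C σ σ′ σ″ t} k {d} → eval e σ ≢ nil → Run C σ σ′ t →
    Run (while e loop C) σ′ σ″ (k * (1 + cost e + t) + d) →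
    Run (while e loop C) σ σ″ (suc k * (1 + cost e + t) + d)
  again {e} {t = t} k {d} p (run x b) (run y b′) = run (while-true p x y)
    (≤-trans (+-mono-≤ (+-monoʳ-≤ (1 + cost e) b) b′) (≤-reflexive (sym (+-assoc (1 + cost e + t) (k * (1 + cost e + t)) d))))

  once : ∀ {e C σ σ′ σ″ t t′} → eval e σ ≢ nil → Run C σ σ′ t →
    Run (while e loop C) σ′ σ″ t′ → Run (while e loop C) σ σ″ (1 + cost e + t + t′)
  once {e} p (run x b) (run y b′) = run (while-true p x y) (+-mono-≤ (+-monoʳ-≤ (1 + cost e) b) b′)

  -- The test costs 2, so a body of cost at most 18 stays within 20 per bit; the final 2 is for the
  -- failing test.
  tick : ∀ {i C σ σ′ σ″ t} m {_ : Bool.T (t ≤ᵇ 18)} → lookup σ i ≢ nil → Run C σ σ′ t →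
    Run (while var i loop C) σ′ σ″ (m * 20 + 2) → Run (while var i loop C) σ σ″ (suc m * 20 + 2)
  tick m {t≤} p r = again m p (within! {p = t≤} r)

  count-run : ∀ {m o ρ₂ ρ₃ ρ₄ ρ₅ ρ₆ ρ₇ ρ} b (p : Subset m) →
    Run countLoop (o ∷ encodeℕ b ∷ ρ₂ ∷ ρ₃ ∷ ρ₄ ∷ ρ₅ ∷ ρ₆ ∷ ρ₇ ∷ encodeSubset p ∷ ρ)
                  (o ∷ encodeℕ (∣ p ∣ + b) ∷ ρ₂ ∷ ρ₃ ∷ ρ₄ ∷ ρ₅ ∷ ρ₆ ∷ ρ₇ ∷ nil ∷ ρ) (m * 20 + 2)
  count-run b []          = stop refl
  count-run {suc m} {o} {ρ₂} {ρ₃} {ρ₄} {ρ₅} {ρ₆} {ρ₇} {ρ} b (true ∷ p)  = tick m (λ ()) (true! (λ ()) set ▸ set)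
    (into (cong (λ k → o ∷ encodeℕ k ∷ ρ₂ ∷ ρ₃ ∷ ρ₄ ∷ ρ₅ ∷ ρ₆ ∷ ρ₇ ∷ nil ∷ ρ) (+-suc ∣ p ∣ b)) (count-run (suc b) p))
  count-run {suc m} b (false ∷ p) =
    tick m (λ ()) (false! refl nop ▸ set) (count-run b p)

  -- The tail of `nil` is `nil`, which makes the loop compute truncated subtraction.
  measure-run : ∀ {m o b d z ρ} k (p : Subset m) →
    Run measureLoop (o ∷ b ∷ d ∷ encodeℕ k ∷ z ∷ encodeSubset p ∷ ρ)
                    (o ∷ b ∷ d ∷ encodeℕ (k ∸ ∣ p ∣) ∷ z ∷ nil ∷ ρ) (m * 20 + 2)
  measure-run k       []          = stop refl
  measure-run {suc m} {o} {b} {d} {z} {ρ} zero (true ∷ p) = tick m (λ ()) (true! (λ ()) set ▸ set)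
    (into (cong (λ k → o ∷ b ∷ d ∷ encodeℕ k ∷ z ∷ nil ∷ ρ) (0∸n≡0 ∣ p ∣)) (measure-run zero p))
  measure-run {suc m} (suc k) (true ∷ p)  = tick m (λ ()) (true! (λ ()) set ▸ set) (measure-run k p)
  measure-run {suc m} k       (false ∷ p) = tick m (λ ()) (false! refl nop ▸ set) (measure-run k p)

  compare-run : ∀ {m o b ρ} d (p q : Subset m) →
    Run compareLoop (o ∷ b ∷ encodeBool d ∷ encodeSubset p ∷ encodeSubset q ∷ ρ)
                    (o ∷ b ∷ encodeBool (differs d p q) ∷ nil ∷ nil ∷ ρ) (m * 20 + 2)
  compare-run d []          []          = stop refl
  compare-run {suc m} d (true ∷ p)  (true ∷ q)  =
    tick m (λ ()) (true! (λ ()) (true! (λ ()) nop) ▸ set ▸ set) (compare-run d p q)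
  compare-run {suc m} d (true ∷ p)  (false ∷ q) =
    tick m (λ ()) (true! (λ ()) (false! refl set) ▸ set ▸ set) (compare-run true p q)
  compare-run {suc m} d (false ∷ p) (true ∷ q)  =
    tick m (λ ()) (false! refl (true! (λ ()) set) ▸ set ▸ set) (compare-run true p q)
  compare-run {suc m} d (false ∷ p) (false ∷ q) =
    tick m (λ ()) (false! refl (false! refl nop) ▸ set ▸ set) (compare-run d p q)

  absorb : ∀ h x a b {k} {_ : Bool.T (h + (a + b) ≤ᵇ k)} → h + ((x + a) + b) ≤ k + x
  absorb h x a b {k} {p} = begin
    h + ((x + a) + b)  ≡⟨ solve 4 (λ h x a b → h :+ ((x :+ a) :+ b) := (h :+ (a :+ b)) :+ x) refl h x a b ⟩
    h + (a + b) + x    ≤⟨ +-monoˡ-≤ x (≤ᵇ⇒≤ (h + (a + b)) k p) ⟩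
    k + x              ∎
    where
    open ≤-Reasoning
    open +-*-Solver

  absent : Subset n → Bool → List (Subset n) → Bool
  absent w k us = k ∧ not (does (any? (_≟ˢ w) us))

  member-run : ∀ {o b ρ} w k us →
    Run memberLoop (o ∷ b ∷ nil ∷ nil ∷ nil ∷ encodeFamily us ∷ encodeBool k ∷ encodeSubset w ∷ ρ)
                   (o ∷ b ∷ nil ∷ nil ∷ nil ∷ nil ∷ encodeBool (absent w k us) ∷ encodeSubset w ∷ ρ)
                   (length us * (20 + n * 20) + 2)
  member-run w k []       rewrite Bool.∧-identityʳ k = stop refl
  member-run {o} {b} {ρ} w k (u ∷ us) = again (length us) {2} (λ ())
    -- 5 and 9 are the costs before and after the comparison, whose own cost is `n * 20 + 2`; 18
    -- plus the test gives the 20 of the bound.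
    (within (absorb 5 (n * 20) 2 9 {18}) (set ▸ set ▸ compare-run false u w ▸ verdict ▸ set ▸ set))
    (into (cong (λ k → o ∷ b ∷ nil ∷ nil ∷ nil ∷ nil ∷ encodeBool k ∷ encodeSubset w ∷ ρ) step)
      (member-run w (k ∧ not (does (u ≟ˢ w))) us))
    where
    verdict : Run (if var D then skip else (OK ≔ `nil))
      (o ∷ b ∷ encodeBool (differs false u w) ∷ nil ∷ nil ∷ encodeFamily (u ∷ us) ∷ encodeBool k ∷ encodeSubset w ∷ ρ)
      (o ∷ b ∷ encodeBool (differs false u w) ∷ nil ∷ nil
        ∷ encodeFamily (u ∷ us) ∷ encodeBool (k ∧ not (does (u ≟ˢ w))) ∷ encodeSubset w ∷ ρ) 4
    verdict with u ≟ˢ w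
    ... | yes refl rewrite differs-refl false u | Bool.∧-zeroʳ k = false! refl set
    ... | no u≢w   rewrite differs-≢ u w u≢w | Bool.∧-identityʳ k = within! (true! (λ ()) nop)
    step : absent w (k ∧ not (does (u ≟ˢ w))) us ≡ absent w k (u ∷ us)
    step = trans (Bool.∧-assoc k _ _) (cong (k ∧_) (sym (deMorgan₂ Bool.∨-∧-booleanAlgebra (does (u ≟ˢ w)) _)))

  -- Execution of the search.

  module Search (x : ℕ) where
    open Excess x

    Good : List (Subset n) → Set
    Good As = Unique As × All Small As

    good-length : ∀ {As} → Good As → length As ≤ countBound
    good-length (As! , As-small) = small-count As! As-small

    node : (w t v s : Tree) (Qs As : List (Subset n)) → Store 13
    node w t v s Qs As = nil ∷ encodeℕ (suc sizeBound) ∷ nil ∷ nil ∷ nil ∷ nil ∷ nil ∷ w ∷ t ∷ v ∷ s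
      ∷ encodeFamily Qs ∷ encodeFamily As ∷ []

    insertTime-mono : ∀ {l l′} → l ≤ l′ → insertTime n l ≤ insertTime n l′
    insertTime-mono l≤ =
      +-monoʳ-≤ (4 + (n * 20 + 2)) (+-monoʳ-≤ 2 (+-monoˡ-≤ 12 (+-monoʳ-≤ 8 (+-monoˡ-≤ 2 (*-monoˡ-≤ (20 + n * 20) l≤)))))

    encodeℕ-≢nil : ∀ {k} → 0 < k → encodeℕ k ≢ nil
    encodeℕ-≢nil (s≤s _) ()

    Inserted : Subset n → (t v s : Tree) (Qs As : List (Subset n)) → Set
    Inserted w t v s Qs As = ∃[ Qs′ ] ∃[ As′ ]
      ( Run insert (node (encodeSubset w) t v s Qs As) (node (encodeSubset w) t v s Qs′ As′) (insertTime n countBound)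
      × Grow As Qs As′ Qs′ × Good As′ × (∣ w ∣ ≤ sizeBound → w ∈ˡ As′))

    insert-run : ∀ w {t v s Qs As} → 𝐅 w → Good As → Inserted w t v s Qs As
    insert-run w {t} {v} {s} {Qs} {As} w∈ good@(As! , As-small) =
      -- The run of `memberLoop` is passed along with the decision that its final store mentions, so
      -- that matching on the decision evaluates `OK`.
      cases (∣ w ∣ ≤? sizeBound) (any? (_≟ˢ w) As) (member-run w true As)
      where
      cases : Dec (∣ w ∣ ≤ sizeBound) → (m? : Dec _) →
        Run memberLoop
          (nil ∷ encodeℕ (suc sizeBound) ∷ nil ∷ nil ∷ nil ∷ encodeFamily As ∷ encodeBool true
          ∷ encodeSubset w ∷ t ∷ v ∷ s ∷ encodeFamily Qs ∷ encodeFamily As ∷ [])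
          (nil ∷ encodeℕ (suc sizeBound) ∷ nil ∷ nil ∷ nil ∷ nil ∷ encodeBool (not (does m?))
            ∷ encodeSubset w ∷ t ∷ v ∷ s ∷ encodeFamily Qs ∷ encodeFamily As ∷ [])
          (length As * (20 + n * 20) + 2) → Inserted w t v s Qs As
      cases (no w≰) _ _ = Qs , As ,
        within (+-monoʳ-≤ (4 + (n * 20 + 2)) (s≤s (s≤s (s≤s z≤n))))
          ((set ▸ set ▸
              into (cong (λ k → nil ∷ encodeℕ (suc sizeBound) ∷ nil ∷ encodeℕ k ∷ nil ∷ nil
              ∷ nil ∷ encodeSubset w ∷ t ∷ v ∷ s ∷ encodeFamily Qs ∷ encodeFamily As ∷ [])
              (m≤n⇒m∸n≡0 (≰⇒> w≰)))
              (measure-run (suc sizeBound) w))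
            ▸ false! refl nop) ,
        done , good , λ w≤ → contradiction w≤ w≰
      cases (yes w≤) (yes w∈As) lookup = Qs , As ,
        within (insertTime-mono (good-length good))
          ((set ▸ set ▸ measure-run (suc sizeBound) w)
            ▸ true! (encodeℕ-≢nil (m<n⇒0<n∸m (s≤s w≤)))
               ((set ▸ set ▸ set ▸ lookup) ▸ within! (false! refl nop))) ,
        done , good , λ _ → Any.map sym w∈As
      cases (yes w≤) (no w∉As) lookup = w ∷ Qs , w ∷ As ,
        within (insertTime-mono (good-length good))
          ((set ▸ set ▸ measure-run (suc sizeBound) w)
            ▸ true! (encodeℕ-≢nil (m<n⇒0<n∸m (s≤s w≤)))
               ((set ▸ set ▸ set ▸ lookup) ▸ true! (λ ()) (set ▸ set ▸ set))) ,
        push w done ,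
        (All.tabulate (λ y∈ w≡y → w∉As (Any.map (λ y≡ → trans (sym y≡) (sym w≡y)) y∈)) ∷ As! , (w∈ , w≤) ∷ As-small) ,
        λ _ → here refl

    Visited : Subset n → Maybe (Subset n) → (t v : Tree) (Qs As : List (Subset n)) → Set
    Visited X a t v Qs As = ∃[ Qs′ ] ∃[ As′ ]
      ( Run visit (node nil t v (encodeSubset X) Qs As) (node nil t v (encodeSubset X) Qs′ As′) (visitTime c n countBound)
      × Grow As Qs As′ Qs′ × Good As′ × (∀ {w} → a ≡ just w → ∣ w ∣ ≤ sizeBound → w ∈ˡ As′))

    visit-run : ∀ {X v t i Qs As} → 𝐅 X → v ∈ X → encodeℕ i ≡ encodeFin v → Good As →
      Visited X (witness X v) t (encodeℕ i) Qs As
    visit-run {X} {v} {t} {i} {Qs} {As} X∈ v∈ i≡v good =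
      -- The answer is generalised to `a`, so that a case split on it evaluates the store after the
      -- call; its correctness puts the returned set into the family.
      answer (witness X v) (witness-correct X∈ v∈) (run (call-witness refl i≡v X∈ v∈) (+-monoʳ-≤ 3 (witnessTime-bound X∈ v∈)))
      where
      answer : ∀ a → IsWitnessAnswer X v a →
        Run (W ≔witness var S , var V) (node nil t (encodeℕ i) (encodeSubset X) Qs As)
          (node (encodeMaybe encodeSubset a) t (encodeℕ i) (encodeSubset X) Qs As) (3 + c * n ^ 3) →
        Visited X a t (encodeℕ i) Qs As
      answer nothing  _ call = Qs , As ,
        within (+-monoʳ-≤ (3 + c * n ^ 3) (s≤s (s≤s (s≤s z≤n)))) (call ▸ false! refl nop) , done , good , λ ()
      answer (just w) ((w∈ , _) , _) call with insert-run w {t} {encodeℕ i} {encodeSubset X} {Qs} {As} w∈ good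
      ... | Qs′ , As′ , ins , grow , good′ , found = Qs′ , As′ ,
        (call ▸ true! (λ ()) (set ▸ ins ▸ set)) , grow , good′ , λ { refl → found }

    -- ι embeds the positions of p, the part of X that is still to be scanned, into those of X.
    visitLoop-run : ∀ {m X Qs As} (p : Subset m) i (ι : Fin m → Fin n) → (∀ j → toℕ (ι j) ≡ i + toℕ j) →
      (∀ {j} → j ∈ p → ι j ∈ X) → 𝐅 X → Good As →
      ∃[ Qs′ ] ∃[ As′ ] ∃[ v′ ]
          (Run visitLoop (node nil (encodeSubset p) (encodeℕ i) (encodeSubset X) Qs As)
          (node nil nil v′ (encodeSubset X) Qs′ As′)
          (∣ p ∣ * visitTime c n countBound + (m * 20 + 2))
        × Grow As Qs As′ Qs′ × Good As′
        × (∀ {j w} → j ∈ p → witness X (ι j) ≡ just w → ∣ w ∣ ≤ sizeBound → w ∈ˡ As′))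
    visitLoop-run {Qs = Qs} {As} [] i ι ι-pos ι-mem X∈ good = Qs , As , _ , stop refl , done , good , λ ()
    visitLoop-run {suc m} {X} {Qs} {As} (false ∷ p) i ι ι-pos ι-mem X∈ good
      with visitLoop-run {m} {X} {Qs} {As} p (suc i) (ι ∘ suc)
          (λ j → trans (ι-pos (suc j)) (+-suc i (toℕ j))) (ι-mem ∘ thereⱽ) X∈ good
    ... | Qs′ , As′ , v′ , r , grow , good′ , found = Qs′ , As′ , v′ ,
      within (skipped (∣ p ∣ * visitTime c n countBound) (m * 20 + 2))
        (once (λ ()) (false! refl nop ▸ set ▸ set) r) , grow , good′ ,
      λ { (thereⱽ j∈) → found j∈ }
      where
      skipped : ∀ a b → 13 + (a + b) ≤ a + (20 + b)
      skipped a b = ≤-trans (≤-reflexive (solve 2 (λ a b → con 13 :+ (a :+ b) := a :+ (con 13 :+ b)) refl a b))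
        (+-monoʳ-≤ a (+-monoˡ-≤ b (m≤m+n 13 7)))
        where open +-*-Solver
    visitLoop-run {suc m} {X} {Qs} {As} (true ∷ p) i ι ι-pos ι-mem X∈ good
      with visit-run {X} {ι zero} {encodeSubset (true ∷ p)} {i} {Qs} {As}
          X∈ (ι-mem hereⱽ) (cong encodeℕ (sym (trans (ι-pos zero) (+-identityʳ i)))) good
    ... | Qs₁ , As₁ , r₁ , grow₁ , good₁ , found₁
      with visitLoop-run {m} {X} {Qs₁} {As₁} p (suc i) (ι ∘ suc)
          (λ j → trans (ι-pos (suc j)) (+-suc i (toℕ j))) (ι-mem ∘ thereⱽ) X∈ good₁
    ... | Qs′ , As′ , v′ , r , grow , good′ , found = Qs′ , As′ , v′ ,
      within (visited (visitTime c n countBound) (∣ p ∣ * visitTime c n countBound) (m * 20 + 2))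
        (once (λ ()) (true! (λ ()) r₁ ▸ set ▸ set) r) , Grow-trans grow₁ grow , good′ ,
      λ { hereⱽ eq w≤ → Grow-⊆ grow (found₁ eq w≤) ; (thereⱽ j∈) → found j∈ }
      where
      visited : ∀ t a b → 2 + ((3 + t) + 7) + (a + b) ≤ (t + a) + (20 + b)
      visited t a b =
        ≤-trans (≤-reflexive (solve 3 (λ t a b → con 2 :+ ((con 3 :+ t) :+ con 7) :+ (a :+ b) := (t :+ a) :+ (con 12 :+ b))
        refl t a b))
        (+-monoʳ-≤ (t + a) (+-monoˡ-≤ b (m≤m+n 12 8)))
        where open +-*-Solver

    Processed : List (Subset n) → Subset n → Set
    Processed As X = ∀ {v w} → v ∈ X → witness X v ≡ just w → ∣ w ∣ ≤ sizeBound → w ∈ˡ As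

    -- p sets have been expanded already; as A never exceeds countBound, the fuel k lasts until Q is empty.
    searchLoop-run : ∀ k p {Qs As} → k + p ≡ countBound → p + length Qs ≡ length As → Good As →
      (∀ {X} → X ∈ˡ Qs → X ∈ˡ As) → (∀ {X} → X ∈ˡ As → X ∈ˡ Qs ⊎ Processed As X) →
      ∃[ As′ ] ( Run searchLoop (node nil nil nil nil Qs As) (node nil nil nil nil [] As′)
          (k * (2 + expandTime c n sizeBound countBound) + 2)
        × Good As′ × (∀ {X} → X ∈ˡ As → X ∈ˡ As′) × (∀ {X} → X ∈ˡ As′ → Processed As′ X))
    searchLoop-run k p {[]} {As} _ _ good _ status = As , within (m≤n+m 2 _) (stop refl) , good , id , λ X∈ → processed (status X∈)
      where
      processed : ∀ {X} → X ∈ˡ [] ⊎ Processed As X → Processed As X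
      processed (inj₂ q) = q
    searchLoop-run zero p {X ∷ Qs} {As} refl len good _ _ =
      contradiction (≤-trans (≤-reflexive (trans (sym (+-suc p (length Qs))) len)) (good-length good)) (<⇒≱ (s≤s (m≤m+n p _)))
    searchLoop-run (suc k) p {X ∷ Qs} {As} k+p len good queued status
      with visitLoop-run {n} {X} {Qs} {As} X 0 id (λ _ → refl) id (proj₁ (All.lookup (proj₂ good) (queued (here refl)))) good
    ... | Qs₁ , As₁ , v₁ , r₁ , grow , good₁ , found
      with searchLoop-run k (suc p) {Qs₁} {As₁} (trans (+-suc k p) k+p) (Grow-length grow (trans (sym (+-suc p _)) len)) good₁
             (λ Z∈ → Grow-queued grow (queued ∘ there) Z∈) status₁
      where
      -- The set just taken from the queue becomes processed by `found`; those processed earlier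
      -- remain so because `A` only grows.
      kept : ∀ {Z} → Z ∈ˡ X ∷ Qs ⊎ Processed As Z → Z ∈ˡ Qs₁ ⊎ Processed As₁ Z
      kept (inj₁ (here refl)) = inj₂ found
      kept (inj₁ (there Z∈))  = inj₁ (Grow-⊇ʳ grow Z∈)
      kept (inj₂ processed)   = inj₂ λ v∈ eq w≤ → Grow-⊆ grow (processed v∈ eq w≤)
      status₁ : ∀ {Z} → Z ∈ˡ As₁ → Z ∈ˡ Qs₁ ⊎ Processed As₁ Z
      status₁ Z∈ with Grow-new grow Z∈
      ... | inj₁ Z∈As = kept (status Z∈As)
      ... | inj₂ Z∈Qs = inj₁ Z∈Qs
    ... | As′ , r , good′ , ⊆ , processed = As′ ,
      again k {2} (λ ())
        -- Only members of `X` cause witness calls, and `X` has at most `sizeBound` of them: this is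
        -- the source of the factor `r + x`.
        (within (+-monoʳ-≤ 8 (+-monoˡ-≤ 4 (+-monoˡ-≤ (n * 20 + 2)
          (*-monoˡ-≤ (visitTime c n countBound) (proj₂ (All.lookup (proj₂ good) (queued (here refl))))))))
          ((set ▸ set ▸ set) ▸ r₁ ▸ set ▸ set)) r ,
      good′ , ⊆ ∘ Grow-⊆ grow , processed

  -- Execution of the filtering.

  subtract-run : ∀ {m o b ρ} ds (p q : Subset m) →
    Run subtractLoop (o ∷ b ∷ encodeList encodeBool ds ∷ encodeSubset q ∷ encodeSubset p ∷ ρ)
                     (o ∷ b ∷ encodeList encodeBool (toList (p ─ q) ʳ++ ds) ∷ nil ∷ nil ∷ ρ) (m * 20 + 2)
  subtract-run         ds []      []          = stop refl
  subtract-run {suc m} ds (a ∷ p) (true ∷ q)  = tick m (λ ()) (true! (λ ()) set ▸ set ▸ set) (subtract-run (false ∷ ds) p q)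
  subtract-run {suc m} ds (a ∷ p) (false ∷ q) = tick m (λ ()) (false! refl set ▸ set ▸ set) (subtract-run (a ∷ ds) p q)

  restore-run : ∀ {o b y ρ} ds zs →
    Run restoreLoop (o ∷ b ∷ encodeList encodeBool ds ∷ y ∷ encodeList encodeBool zs ∷ ρ)
                    (o ∷ b ∷ nil ∷ y ∷ encodeList encodeBool (ds ʳ++ zs) ∷ ρ) (length ds * 20 + 2)
  restore-run []       zs = stop refl
  restore-run (d ∷ ds) zs = tick (length ds) (λ ()) (set ▸ set) (restore-run ds (d ∷ zs))

  difference-run : ∀ {o b ρ} (p q : Subset n) →
    Run (subtractLoop ⨾ restoreLoop) (o ∷ b ∷ nil ∷ encodeSubset q ∷ encodeSubset p ∷ ρ)
                                     (o ∷ b ∷ nil ∷ nil ∷ encodeSubset (p ─ q) ∷ ρ) ((n * 20 + 2) + (n * 20 + 2))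
  difference-run {o} {b} {ρ} p q = subtract-run [] p q ▸
    within (≤-reflexive (cong (λ k → k * 20 + 2) len))
      (into (cong (λ zs → o ∷ b ∷ nil ∷ nil ∷ encodeList encodeBool zs ∷ ρ) twice) (restore-run (bits ʳ++ []) []))
    where
    bits : List Bool
    bits = toList (p ─ q)
    len : length (bits ʳ++ []) ≡ n
    len = trans (length-ʳ++ bits) (trans (+-identityʳ _) (Vec.length-toList (p ─ q)))
    twice : (bits ʳ++ []) ʳ++ [] ≡ bits
    twice = trans (ʳ++-ʳ++ bits) (++-identityʳ bits)

  peelIf : Bool → Subset n → Subset n → Subset n
  peelIf true  R X = R ─ X
  peelIf false R X = R

  peel : Subset n → Subset n → List (Subset n) → Subset n
  peel X R []       = R
  peel X R (Z ∷ Zs) = peel X (peelIf (does (Z ≺? X)) R Z) Zs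

  ∈-peel⁺ : ∀ {X R v} Zs → v ∈ R → (∀ {Z} → Z ∈ˡ Zs → Z ≺ X → v ∉ Z) → v ∈ peel X R Zs
  ∈-peel⁺ []       v∈ ∉ = v∈
  ∈-peel⁺ {X} (Z ∷ Zs) v∈ ∉ with Z ≺? X
  ... | yes Z≺X = ∈-peel⁺ Zs (x∈p∧x∉q⇒x∈p─q v∈ (∉ (here refl) Z≺X)) (∉ ∘ there)
  ... | no _    = ∈-peel⁺ Zs v∈ (∉ ∘ there)

  ∈-peel⁻ : ∀ {X R v} Zs → v ∈ peel X R Zs → v ∈ R × (∀ {Z} → Z ∈ˡ Zs → Z ≺ X → v ∉ Z)
  ∈-peel⁻ []       v∈ = v∈ , λ ()
  ∈-peel⁻ {X} {R} (Z ∷ Zs) v∈ with Z ≺? X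
  ... | yes Z≺X = let (v∈R─Z , ∉) = ∈-peel⁻ Zs v∈ in
    p─q⊆p R Z v∈R─Z , λ { (here refl) _ → x∈p─q⇒x∉q R Z v∈R─Z ; (there Z∈) → ∉ Z∈ }
  ... | no Z⊀X  = let (v∈R , ∉) = ∈-peel⁻ Zs v∈ in
    v∈R , λ { (here refl) Z≺X → contradiction Z≺X Z⊀X ; (there Z∈) → ∉ Z∈ }

  peel-run : ∀ {o b u k v ρ} X R Zs → 𝐅 X → All 𝐅 Zs →
    Run peelLoop (o ∷ b ∷ nil ∷ nil ∷ encodeSubset R ∷ u ∷ k ∷ nil ∷ encodeFamily Zs ∷ v ∷ encodeSubset X ∷ ρ)
                 (o ∷ b ∷ nil ∷ nil ∷ encodeSubset (peel X R Zs) ∷ u ∷ k ∷ nil ∷ nil ∷ v ∷ encodeSubset X ∷ ρ)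
                 (length Zs * (2 + peelTime c n) + 2)
  peel-run X R []       X∈ []         = stop refl
  peel-run {o} {b} {u} {k} {v} {ρ} X R (Z ∷ Zs) X∈ (Z∈ ∷ Zs∈) = again (length Zs) {2} (λ ())
    (run (call-≺ refl refl Z∈ X∈) (+-monoʳ-≤ 4 (≤-trans (≺Time-bound Z∈ X∈) (*-monoʳ-≤ c (∣p∣≤n Z))))
      ▸ branch (does (Z ≺? X)) ▸ set ▸ set)
    (peel-run X (peelIf (does (Z ≺? X)) R Z) Zs X∈ Zs∈)
    where
    branch : ∀ d → Run (if var W then (Y ≔ `hd (var T) ⨾ subtractLoop ⨾ restoreLoop) else skip)
      (o ∷ b ∷ nil ∷ nil ∷ encodeSubset R ∷ u ∷ k ∷ encodeBool d ∷ encodeFamily (Z ∷ Zs) ∷ v ∷ encodeSubset X ∷ ρ)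
      (o ∷ b ∷ nil ∷ nil ∷ encodeSubset (peelIf d R Z) ∷ u ∷ k ∷ encodeBool d ∷ encodeFamily (Z ∷ Zs) ∷ v ∷ encodeSubset X ∷ ρ)
      (2 + (3 + ((n * 20 + 2) + (n * 20 + 2))))
    branch true  = true! (λ ()) (set ▸ difference-run R Z)
    branch false = within (s≤s (s≤s (s≤s z≤n))) (false! refl nop)

  inhabited-run : ∀ {m o b d y u ρ} k (p : Subset m) →
    Run inhabitedLoop (o ∷ b ∷ d ∷ y ∷ encodeSubset p ∷ u ∷ encodeBool k ∷ ρ)
                      (o ∷ b ∷ d ∷ y ∷ nil ∷ u ∷ encodeBool (inhabited k p) ∷ ρ) (m * 20 + 2)
  inhabited-run         k []          = stop refl
  inhabited-run {suc m} k (true ∷ p)  = tick m (λ ()) (true! (λ ()) set ▸ set) (inhabited-run true p)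
  inhabited-run {suc m} k (false ∷ p) = tick m (λ ()) (false! refl nop ▸ set) (inhabited-run k p)

  module Filter (b : Tree) (As : List (Subset n)) (As∈ : All 𝐅 As)
    (downClosed : ∀ {X Z} → X ∈ˡ As → Z ≺ X → Z ∈ˡ As) where

    shelf : (Os Us : List (Subset n)) → Store 13
    shelf Os Us =
      encodeFamily Os ∷ b ∷ nil ∷ nil ∷ nil ∷ encodeFamily Us ∷ nil ∷ nil ∷ nil ∷ nil ∷ nil ∷ nil ∷ encodeFamily As ∷ []

    principal⁺ : ∀ {X} → Principal X → inhabited false (peel X X As) ≡ true
    principal⁺ {X} (_ , v , v∈hat) with ∈-comprehension⁻ (inHat? X) v∈hat
    ... | v∈X , new = inhabited⁺ (∈-peel⁺ As v∈X λ {Z} Z∈ Z≺X v∈Z → new (Z , proj₁ (≺⇒𝐅 Z≺X) , Z≺X , v∈Z))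

    -- By `downClosed` the listed sets below `X` are all the sets below `X`, so whatever survives
    -- the peeling is in the hat.
    principal⁻ : ∀ {X} → X ∈ˡ As → inhabited false (peel X X As) ≡ true → Principal X
    principal⁻ {X} X∈ eq with inhabited⁻ (peel X X As) eq
    ... | v , v∈ with ∈-peel⁻ As v∈
    ...   | v∈X , new = All.lookup As∈ X∈ , v ,
      ∈-comprehension⁺ (inHat? X) (v∈X , λ (Z , _ , Z≺X , v∈Z) → new (downClosed X∈ Z≺X) Z≺X v∈Z)

    keepIf : Bool → Subset n → List (Subset n) → List (Subset n)
    keepIf true  X Os = X ∷ Os
    keepIf false X Os = Os

    Filtered : (Os Us Os′ : List (Subset n)) → Set
    Filtered Os Us Os′ = Unique Os′ ×
      (∀ {X} → X ∈ˡ Os′ → X ∈ˡ Os ⊎ (X ∈ˡ Us × Principal X)) ×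
      (∀ {X} → X ∈ˡ Os ⊎ (X ∈ˡ Us × Principal X) → X ∈ˡ Os′)

    filterLoop-run : ∀ {Os} Us → (∀ {X} → X ∈ˡ Us → X ∈ˡ As) → Unique Us → Unique Os →
      (∀ {X} → X ∈ˡ Us → X ∉ˡ Os) →
      ∃[ Os′ ] (Run filterLoop (shelf Os Us) (shelf Os′ []) (length Us * (2 + selectTime c n (length As)) + 2) × Filtered Os Us Os′)
    filterLoop-run {Os} [] _ _ Os! _ = Os , stop refl , Os! , inj₁ , λ { (inj₁ X∈) → X∈ ; (inj₂ (() , _)) }
    filterLoop-run {Os} (X ∷ Us) ⊆As (X∉Us ∷ Us!) Os! disjoint = combine (inhabited false (peel X X As)) refl
      where
      X∈As : X ∈ˡ As
      X∈As = ⊆As (here refl)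
      body : ∀ {k} → inhabited false (peel X X As) ≡ k →
        Run select (shelf Os (X ∷ Us)) (shelf (keepIf k X Os) Us)
        (selectTime c n (length As))
      body refl =
        (set ▸ set ▸ set) ▸ peel-run X X As (All.lookup As∈ X∈As) As∈ ▸ inhabited-run false (peel X X As)
        ▸ keep (inhabited false (peel X X As)) ▸ set ▸ set ▸ set
        where
        keep : ∀ k → Run (if var OK then out ≔ `cons (var S) (var out) else skip)
          (encodeFamily Os ∷ b ∷ nil ∷ nil ∷ nil ∷ encodeFamily (X ∷ Us)
            ∷ encodeBool k ∷ nil ∷ nil ∷ nil ∷ encodeSubset X ∷ nil ∷ encodeFamily As ∷ [])
          (encodeFamily (keepIf k X Os) ∷ b ∷ nil ∷ nil ∷ nil ∷ encodeFamily (X ∷ Us)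
            ∷ encodeBool k ∷ nil ∷ nil ∷ nil ∷ encodeSubset X ∷ nil ∷ encodeFamily As ∷ []) 6
        keep true  = true! (λ ()) set
        keep false = within! (false! refl nop)
      Result : Set
      Result = ∃[ Os′ ]
          (Run filterLoop (shelf Os (X ∷ Us)) (shelf Os′ [])
          (suc (length Us) * (2 + selectTime c n (length As)) + 2)
          × Filtered Os (X ∷ Us) Os′)
      combine : ∀ k → inhabited false (peel X X As) ≡ k → Result
      combine true eq
        with filterLoop-run {X ∷ Os} Us (⊆As ∘ there) Us!
               (All.tabulate (λ y∈ X≡y → disjoint (here refl) (subst (_∈ˡ Os) (sym X≡y) y∈)) ∷ Os!)
               (λ { y∈ (here refl) → All.lookup X∉Us y∈ refl ; y∈ (there y∈Os) → disjoint (there y∈) y∈Os })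
      ... | Os′ , r , Os′! , sound , complete =
        Os′ , again (length Us) {2} (λ ()) (body eq) r ,
        Os′! , sound′ ∘ sound , complete ∘ complete′
        where
        sound′ : ∀ {Z} → Z ∈ˡ X ∷ Os ⊎ (Z ∈ˡ Us × Principal Z) → Z ∈ˡ Os ⊎ (Z ∈ˡ X ∷ Us × Principal Z)
        sound′ (inj₁ (here refl))  = inj₂ (here refl , principal⁻ X∈As eq)
        sound′ (inj₁ (there Z∈))   = inj₁ Z∈
        sound′ (inj₂ (Z∈ , prin))  = inj₂ (there Z∈ , prin)
        complete′ : ∀ {Z} → Z ∈ˡ Os ⊎ (Z ∈ˡ X ∷ Us × Principal Z) → Z ∈ˡ X ∷ Os ⊎ (Z ∈ˡ Us × Principal Z)
        complete′ (inj₁ Z∈)                 = inj₁ (there Z∈)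
        complete′ (inj₂ (here refl , _))    = inj₁ (here refl)
        complete′ (inj₂ (there Z∈ , prin))  = inj₂ (Z∈ , prin)
      combine false eq with filterLoop-run {Os} Us (⊆As ∘ there) Us! Os! (disjoint ∘ there)
      ... | Os′ , r , Os′! , sound , complete =
        Os′ , again (length Us) {2} (λ ()) (body eq) r ,
        Os′! , sound′ ∘ sound , complete ∘ complete′
        where
        sound′ : ∀ {Z} → Z ∈ˡ Os ⊎ (Z ∈ˡ Us × Principal Z) → Z ∈ˡ Os ⊎ (Z ∈ˡ X ∷ Us × Principal Z)
        sound′ (inj₁ Z∈)           = inj₁ Z∈
        sound′ (inj₂ (Z∈ , prin))  = inj₂ (there Z∈ , prin)
        complete′ : ∀ {Z} → Z ∈ˡ Os ⊎ (Z ∈ˡ X ∷ Us × Principal Z) → Z ∈ˡ Os ⊎ (Z ∈ˡ Us × Principal Z)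
        complete′ (inj₁ Z∈)                   = inj₁ Z∈
        complete′ (inj₂ (here refl , prin))   = contradiction (trans (sym (principal⁺ prin)) eq) λ ()
        complete′ (inj₂ (there Z∈ , prin))    = inj₂ (Z∈ , prin)

  -- Execution of the whole program.

  program-run : ∀ x → let open Excess x in
    ∃[ σ ] ∃[ Ss ] ( Run program (initial n x) σ (totalTime c n sizeBound countBound)
      × lookup σ zero ≡ encodeFamily Ss × Unique Ss × (∀ S → S ∈ˡ Ss ⇔ Pr x S))
  program-run x
    -- At the start nothing is expanded, so the fuel is all of `countBound`, and the queue equals
    -- the list.
    with Search.searchLoop-run x (Excess.countBound x) 0 {sm ∷ []} {sm ∷ []} (+-identityʳ _) refl
           ([] ∷ [] , Excess.sm-small x ∷ []) id inj₁
  ... | As , search , good@(As! , As-small) , ⊆ , processed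
    with Filter.filterLoop-run (encodeℕ (suc (Excess.sizeBound x))) As (All.map proj₁ As-small) downClosed {[]} As id As! [] (λ _ ())
    where
    complete : ∀ {X} → Excess.Small x X → X ∈ˡ As
    complete = Excess.closed⇒complete x (⊆ (here refl)) (λ X∈ → processed X∈)
    downClosed : ∀ {X Z} → X ∈ˡ As → Z ≺ X → Z ∈ˡ As
    downClosed X∈ Z≺X = complete (proj₁ (≺⇒𝐅 Z≺X) , ≤-trans (<⇒≤ (≺⇒< Z≺X)) (proj₂ (All.lookup As-small X∈)))
  ... | Os , filtering , Os! , sound , complete = _ , Os ,
    ((run call-sm (+-monoʳ-≤ 1 smTime-bound) ▸ set ▸ set ▸ set)
      ▸ into (cong (λ k → nil ∷ encodeℕ k ∷ nil ∷ nil ∷ nil ∷ nil ∷ nil ∷ nil ∷ nil ∷ nil ∷ encodeSubset sm ∷ nil ∷ nil ∷ [])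
          (+-suc ∣ sm ∣ x))
          (count-run (suc x) sm)
      ▸ (set ▸ set ▸ set) ▸ search ▸ set ▸ within filterTime-mono filtering) ,
    refl , Os! , λ X → mk⇔ (sound′ ∘ sound) (λ (prin , ex≤) → complete (inj₂ (exhaustive prin ex≤ , prin)))
    where
    open Excess x
    length≤ : length As ≤ countBound
    length≤ = small-count As! As-small
    filterTime-mono : filterTime c n (length As) ≤ filterTime c n countBound
    filterTime-mono =
      +-monoˡ-≤ 2 (*-mono-≤ length≤ (+-monoʳ-≤ 9 (+-monoˡ-≤ _ (+-monoˡ-≤ 2 (*-monoˡ-≤ (2 + peelTime c n) length≤)))))
    sound′ : ∀ {X} → X ∈ˡ [] ⊎ (X ∈ˡ As × Principal X) → Pr x X
    sound′ (inj₂ (X∈ , prin)) = prin , m≤n+o⇒m∸n≤o _ ∣ sm ∣ (proj₂ (All.lookup As-small X∈))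
    exhaustive : ∀ {X} → Principal X → ex X ≤ x → X ∈ˡ As
    exhaustive {X} (X∈ , _) ex≤ = closed⇒complete (⊆ (here refl)) (λ X∈ → processed X∈)
      (X∈ , ≤-trans (m≤n+m∸n ∣ X ∣ ∣ sm ∣) (+-monoʳ-≤ ∣ sm ∣ ex≤))

-- Asymptotic estimate of the running time.

record Bounded (a M k : ℕ) : Set where
  constructor bounded
  field bound≤ : a ≤ k * M

open Bounded

const : ∀ k {M} → 1 ≤ M → Bounded k M k
const k {M} 1≤M = bounded (subst (_≤ k * M) (*-identityʳ k) (*-monoʳ-≤ k 1≤M))

infixr 5 _⊕_
-- The multipliers are indices of a record, so unification finds the constants written `_` below
-- from the shape of the proof.
_⊕_ : ∀ {a b M k l} → Bounded a M k → Bounded b M l → Bounded (a + b) M (k + l)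
_⊕_ {M = M} {k} {l} (bounded p) (bounded q) =
  bounded (≤-trans (+-mono-≤ p q) (≤-reflexive (sym (*-distribʳ-+ M k l))))

lift : ∀ {a M M′ k} → M ≤ M′ → Bounded a M k → Bounded a M′ k
lift {k = k} M≤M′ (bounded p) = bounded (≤-trans p (*-monoʳ-≤ k M≤M′))

scale : ∀ {a b m M k} → a ≤ m → Bounded b M k → Bounded (a * b) (m * M) k
scale {m = m} {M} {k} a≤m (bounded p) = bounded (≤-trans (*-mono-≤ a≤m p)
  (≤-reflexive (solve 3 (λ m k M → m :* (k :* M) := k :* (m :* M)) refl m k M)))
  where open +-*-Solver

-- `K` is fixed before the sizes and depends on `c` only. `N` and `z` bound `n` and `s` and are at
-- least 1, so that constant summands can be absorbed. The dominant part is `l` expansions with at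
-- most `s` witness calls each, a call and the insertion after it costing at most a constant times
-- `l * N ^ 3`.
totalTime-bound : ∀ c → ∃[ K ] ∀ {n s l N z} → n ≤ N → 1 ≤ N → s ≤ z → 1 ≤ z → 1 ≤ l →
  Bounded (totalTime c n s l) (l * (z * (l * N ^ 3))) K
totalTime-bound c = _ , λ n≤N 1≤N s≤z 1≤z 1≤l → total n≤N 1≤N s≤z 1≤z 1≤l
  where
  module _ {n s l N z : ℕ} (n≤N : n ≤ N) (1≤N : 1 ≤ N) (s≤z : s ≤ z) (1≤z : 1 ≤ z) (1≤l : 1 ≤ l) where
    M₁ M₂ M₃ M₄ : ℕ
    M₁ = N ^ 3
    M₂ = l * M₁
    M₃ = z * M₂
    M₄ = l * M₃

    grow : ∀ {k M} → 1 ≤ k → M ≤ k * M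
    grow {k} {M} 1≤k = subst (_≤ k * M) (*-identityˡ M) (*-monoˡ-≤ M 1≤k)

    1≤M₁ : 1 ≤ M₁
    1≤M₁ = ^-monoˡ-≤ 3 1≤N

    M₁≤M₂ : M₁ ≤ M₂
    M₁≤M₂ = grow 1≤l
    M₂≤M₃ : M₂ ≤ M₃
    M₂≤M₃ = grow 1≤z
    M₃≤M₄ : M₃ ≤ M₄
    M₃≤M₄ = grow 1≤l

    1≤M₂ : 1 ≤ M₂
    1≤M₂ = ≤-trans 1≤M₁ M₁≤M₂
    1≤M₃ : 1 ≤ M₃
    1≤M₃ = ≤-trans 1≤M₂ M₂≤M₃
    1≤M₄ : 1 ≤ M₄
    1≤M₄ = ≤-trans 1≤M₃ M₃≤M₄

    times : ∀ {a M} j → a ≤ M → Bounded (j * a) M j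
    times j a≤M = bounded (*-monoʳ-≤ j a≤M)

    n≤M₁ : n ≤ M₁
    n≤M₁ = ≤-trans n≤N (≤-trans (≤-reflexive (sym (*-identityʳ N))) (*-monoʳ-≤ N (^-monoˡ-≤ 2 1≤N)))

    linear : Bounded (n * 20) M₁ 20
    linear = bounded (subst (_≤ 20 * M₁) (*-comm 20 n) (*-monoʳ-≤ 20 n≤M₁))

    cubic : Bounded (c * n ^ 3) M₁ c
    cubic = times c (^-monoˡ-≤ 3 n≤N)

    pass : Bounded (n * 20 + 2) M₁ 22
    pass = linear ⊕ const 2 1≤M₁

    insertion : Bounded (insertTime n l) M₂ _
    insertion = (const 4 1≤M₂ ⊕ lift M₁≤M₂ pass) ⊕
      (const 2 1≤M₂ ⊕ ((const 8 1≤M₂ ⊕ (scale {a = l} ≤-refl (const 20 1≤M₁ ⊕ linear) ⊕ const 2 1≤M₂)) ⊕ const 12 1≤M₂))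

    visiting : Bounded (visitTime c n l) M₂ _
    visiting = (const 3 1≤M₂ ⊕ lift M₁≤M₂ cubic) ⊕ (const 2 1≤M₂ ⊕ (const 3 1≤M₂ ⊕ (insertion ⊕ const 2 1≤M₂)))

    expansion : Bounded (expandTime c n s l) M₃ _
    expansion = const 8 1≤M₃ ⊕ ((scale s≤z visiting ⊕ lift (≤-trans M₁≤M₂ M₂≤M₃) pass) ⊕ const 4 1≤M₃)

    searching : Bounded (searchTime c n s l) M₄ _
    searching = scale {a = l} ≤-refl (const 2 1≤M₃ ⊕ expansion) ⊕ const 2 1≤M₄

    peeling : Bounded (peelTime c n) M₁ _
    peeling = (const 4 1≤M₁ ⊕ times c n≤M₁) ⊕ ((const 2 1≤M₁ ⊕ (const 3 1≤M₁ ⊕ (pass ⊕ pass))) ⊕ const 5 1≤M₁)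

    selection : Bounded (selectTime c n l) M₂ _
    selection = const 7 1≤M₂ ⊕ ((scale {a = l} ≤-refl (const 2 1≤M₁ ⊕ peeling) ⊕ const 2 1≤M₂) ⊕ (lift M₁≤M₂ pass ⊕ const 13 1≤M₂))

    filtering : Bounded (filterTime c n l) M₄ _
    filtering = scale {a = l} ≤-refl (const 2 1≤M₃ ⊕ lift M₂≤M₃ selection) ⊕ const 2 1≤M₄

    total : Bounded (totalTime c n s l) M₄ _
    total = ((const 1 1≤M₄ ⊕ lift M₁≤M₄ cubic) ⊕ const 8 1≤M₄) ⊕
      (lift M₁≤M₄ pass ⊕ (const 8 1≤M₄ ⊕ (searching ⊕ (const 2 1≤M₄ ⊕ filtering))))
      where
      M₁≤M₄ : M₁ ≤ M₄
      M₁≤M₄ = ≤-trans M₁≤M₂ (≤-trans M₂≤M₃ M₃≤M₄)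

-- The two factors `r * 2 ^ suc x` produce the 4 together with `2 ^ (2 * x) * r ^ 2`. Only one
-- factor `r + x` arises; being at least 1, it is at most its square.
bound-dominates : ∀ N r x → 1 ≤ r → (r * 2 ^ suc x) * ((r + x) * ((r * 2 ^ suc x) * N ^ 3)) ≤ 4 * bound N r x
bound-dominates N r x 1≤r = begin
  (r * (2 * 2 ^ x)) * ((r + x) * ((r * (2 * 2 ^ x)) * N ^ 3))
    ≡⟨ solve 4 (λ r e z p → (r :* (con 2 :* e)) :* (z :* ((r :* (con 2 :* e)) :* p))
          := con 4 :* (p :* (e :* e) :* (r :* (r :* con 1)) :* z))
          refl r (2 ^ x) (r + x) (N ^ 3) ⟩
  4 * (N ^ 3 * (2 ^ x * 2 ^ x) * r ^ 2 * (r + x))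
    ≤⟨ *-monoʳ-≤ 4 (*-monoʳ-≤ (N ^ 3 * (2 ^ x * 2 ^ x) * r ^ 2) r+x≤) ⟩
  4 * (N ^ 3 * (2 ^ x * 2 ^ x) * r ^ 2 * (r + x) ^ 2)
    ≡⟨ cong (λ e → 4 * (N ^ 3 * e * r ^ 2 * (r + x) ^ 2))
          (trans (sym (^-distribˡ-+-* 2 x x)) (cong (λ y → 2 ^ (x + y)) (sym (+-identityʳ x)))) ⟩
  4 * bound N r x ∎
  where
  open ≤-Reasoning
  open +-*-Solver
  r+x≤ : r + x ≤ (r + x) ^ 2
  r+x≤ = ≤-trans (≤-reflexive (sym (*-identityʳ (r + x)))) (*-monoʳ-≤ (r + x) (^-monoˡ-≤ 1 (≤-trans 1≤r (m≤m+n r x))))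

-- One program serves all families, and only the constant `K` depends on `c`. Without the maxima
-- with 1 the bound would be 0 for an empty ground set or an empty `sm`, while every execution takes
-- positive time.
theorem3 : ∃[ k ] Σ[ P ∈ Cmd (2 + k) ] ((c : ℕ) → ∃[ K ] ((n : ℕ) (𝓕 : SetFamily n) (I : IsISFamily c 𝓕) (x : ℕ) →
    ComputesPr I P x (K * bound (1 ⊔ n) (1 ⊔ ∣ IsISFamily.sm I ∣) x)))
theorem3 = 11 , program , λ c → let (K , total≤) = totalTime-bound c in K * 4 , λ n 𝓕 I x →
  let r = 1 ⊔ ∣ IsISFamily.sm I ∣
      (σ , Ss , Runs.run exec t≤ , out≡ , Ss! , Ss≗Pr) = Runs.program-run I x
  in σ , _ , Ss , exec ,
     ≤-trans t≤ (≤-trans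
       (bound≤ (total≤ (m≤n⊔m 1 n) (m≤m⊔n 1 n) (+-monoˡ-≤ x (m≤n⊔m 1 ∣ IsISFamily.sm I ∣))
         (≤-trans (m≤m⊔n 1 ∣ IsISFamily.sm I ∣) (m≤m+n r x))
         (*-mono-≤ (m≤m⊔n 1 ∣ IsISFamily.sm I ∣) (m^n>0 2 (suc x)))))
       (≤-trans (*-monoʳ-≤ K (bound-dominates (1 ⊔ n) r x (m≤m⊔n 1 ∣ IsISFamily.sm I ∣)))
         (≤-reflexive (sym (*-assoc K 4 (bound (1 ⊔ n) r x)))))) ,
     out≡ , Ss! , Ss≗Pr
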